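{- Let $\Phi$ be a finite crystallographic root system and let $I\subseteq\Phi^+$ be an order ideal in the root poset. (a) If $\Phi$ is simply laced and $I$ is a star ideal, then $I$ is not line-closed. (b) If $\Phi$ is of type $F_4$ and $I\supseteq\hat I$, where $\hat I$ is the order ideal of all positive roots of height at most $4$, then $I$ is not line-closed.
   Context: Root systems are reduced. Let $\Phi$ be a finite crystallographic root system with positive roots $\Phi^+$ and simple roots $\Delta\subseteq\Phi^+$. Every $\gamma\in\Phi^+$ is uniquely $\gamma=\sum_{\alpha\in\Delta}\gamma_\alpha\alpha$ with nonnegative integers $\gamma_\alpha$; its height is $\sum_{\alpha\in\Delta}\gamma_\alpha$. The root poset is the partial order on $\Phi^+$ given by $\gamma\le\gamma'$ iff $\gamma_\alpha\le\gamma'_\alpha$ for all $\alpha\in\Delta$. An order ideal is a subset $I\subseteq\Phi^+$ such that $\gamma_1\in I$ and $\gamma_2<\gamma_1$ imply $\gamma_2\in I$. $\Phi$ is simply laced if its Dynkin diagram has no multiple bonds. An ideal $I\subseteq\Phi^+$ is a star ideal if there are distinct simple roots $\alpha_1,\alpha_2,\alpha_3,\alpha_4\in\Delta$ such that $\alpha_1+\alpha_2+\alpha_3$, $\alpha_1+\alpha_2+\alpha_4$ and $\alpha_2+\alpha_3+\alpha_4$ all are roots that belong to $I$. In type $F_4$ label the simple roots $\alpha_1,\alpha_2,\alpha_3,\alpha_4$ along the Dynkin diagram so that $\alpha_1,\alpha_2$ are short, $\alpha_3,\alpha_4$ are long, and the double bond joins $\alpha_2$ and $\alpha_3$. Then $\hat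 I$ is the order ideal generated by $\eta_1=\alpha_1+2\alpha_2+\alpha_3$, $\eta_2=\alpha_1+\alpha_2+\alpha_3+\alpha_4$, $\eta_3=2\alpha_2+\alpha_3+\alpha_4$. For a finite set $\mathcal{A}$ of pairwise non-parallel vectors in a Euclidean space (such as $\mathcal{A}=I$), the closure of $S\subseteq\mathcal{A}$ is $\mathrm{cl}(S)=\mathcal{A}\cap\mathrm{span}\,S$, and a flat is a subset $S$ with $\mathrm{cl}(S)=S$. A subset $S\subseteq\mathcal{A}$ is $2$-closed if $\mathrm{cl}(\{a,b\})\subseteq S$ for all $a,b\in S$. $\mathcal{A}$ is line-closed if every $2$-closed subset of $\mathcal{A}$ is a flat of $\mathcal{A}$. -}

module Defs where

open import Algebra.Bundles using (CommutativeRing)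
open import Algebra.Module.Bundles using (Module)
import Algebra.Definitions.RawMonoid as RawMonoidOps
open import Data.Fin.Base using (Fin)
open import Data.Fin.Patterns using (0F; 1F; 2F; 3F)
open import Data.Fin.Subset using (Subset; _∈_; _∉_; _⊆_; ⁅_⁆; _∪_)
open import Data.Integer.Base as ℤ using (ℤ; +_; -[1+_])
open import Data.Nat.Base as ℕ using (ℕ)
open import Data.Product.Base using (∃-syntax; _×_)
open import Data.Sum.Base using (_⊎_)
open import Function.Bundles using (_⇔_; _↔_; Inverse)
open import Level using (Level; _⊔_) renaming (suc to lsuc)
open import Relation.Binary.Core using (Rel)
open import Relation.Binary.PropositionalEquality.Core using (_≡_; _≢_)
open import Relation.Binary.Structures using (IsTotalOrder)
open import Relation.Nullary.Negation.Core using (¬_)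

private
  variable
    c ℓ₁ ℓ₂ m ℓm : Level

-- The scalars of a Euclidean space are taken in an arbitrary ordered field;
-- the field of real numbers is the intended instance.

record OrderedField c ℓ₁ ℓ₂ : Set (lsuc (c ⊔ ℓ₁ ⊔ ℓ₂)) where
  infix 4 _≤_ _<_
  field
    commutativeRing : CommutativeRing c ℓ₁

  open CommutativeRing commutativeRing public

  field
    _≤_           : Rel Carrier ℓ₂
    isTotalOrder  : IsTotalOrder _≈_ _≤_
    +-monoˡ-≤     : ∀ z {x y} → x ≤ y → x + z ≤ y + z
    *-nonNegative : ∀ {x y} → 0# ≤ x → 0# ≤ y → 0# ≤ x * y
    0≉1           : ¬ 0# ≈ 1#
    inverse       : ∀ x → ¬ x ≈ 0# → ∃[ y ] x * y ≈ 1#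

  _<_ : Rel Carrier (ℓ₁ ⊔ ℓ₂)
  x < y = x ≤ y × ¬ x ≈ y

  fromℤ : ℤ → Carrier
  fromℤ (+ n)    = RawMonoidOps._×_ +-rawMonoid n 1#
  fromℤ -[1+ n ] = - RawMonoidOps._×_ +-rawMonoid (ℕ.suc n) 1#

-- Finite dimensionality is not imposed here: it is a consequence of the field
-- `spanning` of `RootSystem`.

record EuclideanSpace (K : OrderedField c ℓ₁ ℓ₂) m ℓm
    : Set (c ⊔ ℓ₁ ⊔ ℓ₂ ⊔ lsuc (m ⊔ ℓm)) where
  private module K = OrderedField K

  field
    vectorSpace : Module K.commutativeRing m ℓm

  open Module vectorSpace public

  field
    ⟪_,_⟫             : Carrierᴹ → Carrierᴹ → K.Carrier
    ⟪⟫-cong           : ∀ {u u′ v v′} → u ≈ᴹ u′ → v ≈ᴹ v′ → ⟪ u , v ⟫ K.≈ ⟪ u′ , v′ ⟫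
    ⟪⟫-comm           : ∀ u v → ⟪ u , v ⟫ K.≈ ⟪ v , u ⟫
    ⟪⟫-+ˡ             : ∀ u v w → ⟪ u +ᴹ v , w ⟫ K.≈ ⟪ u , w ⟫ K.+ ⟪ v , w ⟫
    ⟪⟫-*ˡ             : ∀ k u v → ⟪ k *ₗ u , v ⟫ K.≈ k K.* ⟪ u , v ⟫
    ⟪⟫-nonNegative    : ∀ v → K.0# K.≤ ⟪ v , v ⟫
    ⟪⟫-nondegenerate  : ∀ v → ⟪ v , v ⟫ K.≈ K.0# → v ≈ᴹ 0ᴹ

  linComb : ∀ {n} → (Fin n → K.Carrier) → (Fin n → Carrierᴹ) → Carrierᴹ
  linComb k v = RawMonoidOps.sum +ᴹ-rawMonoid (λ i → k i *ₗ v i)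

-- A finite set 𝒜 of vectors is a subset A of the indices of a finite family v.

module Arrangement {K : OrderedField c ℓ₁ ℓ₂} (E : EuclideanSpace K m ℓm)
                   {n : ℕ} (v : Fin n → EuclideanSpace.Carrierᴹ E) where
  private module K = OrderedField K
  open EuclideanSpace E

  _∈span_ : Carrierᴹ → Subset n → Set (c ⊔ ℓ₁ ⊔ ℓm)
  x ∈span S = ∃[ k ] (∀ i → i ∉ S → k i K.≈ K.0#) × x ≈ᴹ linComb k v

  _∈cl[_]_ : Fin n → Subset n → Subset n → Set (c ⊔ ℓ₁ ⊔ ℓm)
  i ∈cl[ A ] S = i ∈ A × v i ∈span S

  IsFlat : Subset n → Subset n → Set (c ⊔ ℓ₁ ⊔ ℓm)
  IsFlat A S = ∀ i → i ∈cl[ A ] S ⇔ i ∈ S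

  Is2Closed : Subset n → Subset n → Set (c ⊔ ℓ₁ ⊔ ℓm)
  Is2Closed A S = ∀ a b → a ∈ S → b ∈ S → ∀ i → i ∈cl[ A ] (⁅ a ⁆ ∪ ⁅ b ⁆) → i ∈ S

  LineClosed : Subset n → Set (c ⊔ ℓ₁ ⊔ ℓm)
  LineClosed A = ∀ S → S ⊆ A → Is2Closed A S → IsFlat A S

-- A reduced crystallographic root system, its roots listed without repetition.

record RootSystem {K : OrderedField c ℓ₁ ℓ₂} (E : EuclideanSpace K m ℓm)
    : Set (c ⊔ ℓ₁ ⊔ m ⊔ ℓm) where
  private module K = OrderedField K
  open EuclideanSpace E

  field
    size      : ℕ
    root      : Fin size → Carrierᴹ
    injective : ∀ i j → root i ≈ᴹ root j → i ≡ j
    nonzero   : ∀ i → ¬ root i ≈ᴹ 0ᴹ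
    spanning  : ∀ x → ∃[ k ] x ≈ᴹ linComb k root

    -- cartan β α = 2⟪β,α⟫/⟪α,α⟫
    cartan     : Fin size → Fin size → ℤ
    cartan-def : ∀ β α → K.fromℤ (cartan β α) K.* ⟪ root α , root α ⟫
                       K.≈ ⟪ root β , root α ⟫ K.+ ⟪ root β , root α ⟫
    reflection : ∀ β α → ∃[ γ ] root γ ≈ᴹ root β +ᴹ -ᴹ (K.fromℤ (cartan β α) *ₗ root α)

    reduced    : ∀ β α k → root β ≈ᴹ k *ₗ root α → k K.≈ K.1# ⊎ k K.≈ K.- K.1#

  open Arrangement E root public

record Base {K : OrderedField c ℓ₁ ℓ₂} {E : EuclideanSpace K m ℓm} (Φ : RootSystem E)
    : Set (c ⊔ ℓ₁ ⊔ ℓm) where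
  private module K = OrderedField K
  open EuclideanSpace E
  open RootSystem Φ

  field
    rank   : ℕ
    simple : Fin rank → Fin size

  α : Fin rank → Carrierᴹ
  α a = root (simple a)

  field
    independent  : ∀ k → linComb k α ≈ᴹ 0ᴹ → ∀ a → k a K.≈ K.0#
    coeff        : Fin size → Fin rank → ℤ
    coeff-def    : ∀ γ → root γ ≈ᴹ linComb (λ a → K.fromℤ (coeff γ a)) α
    signCoherent : ∀ γ → (∀ a → ℤ.0ℤ ℤ.≤ coeff γ a) ⊎ (∀ a → coeff γ a ℤ.≤ ℤ.0ℤ)

  Positive : Fin size → Set
  Positive γ = ∀ a → ℤ.0ℤ ℤ.≤ coeff γ a

  height : Fin size → ℤ
  height γ = RawMonoidOps.sum ℤ.+-0-rawMonoid (coeff γ)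

  infix 4 _≼_ _≺_

  _≼_ : Fin size → Fin size → Set
  γ ≼ γ′ = ∀ a → coeff γ a ℤ.≤ coeff γ′ a

  _≺_ : Fin size → Fin size → Set
  γ ≺ γ′ = γ ≼ γ′ × γ ≢ γ′

  IsOrderIdeal : Subset size → Set
  IsOrderIdeal I = (∀ γ → γ ∈ I → Positive γ)
                 × (∀ γ₁ γ₂ → γ₁ ∈ I → Positive γ₂ → γ₂ ≺ γ₁ → γ₂ ∈ I)

  -- The number of edges of the Dynkin diagram between two distinct nodes.
  bonds : Fin rank → Fin rank → ℤ
  bonds a b = cartan (simple a) (simple b) ℤ.* cartan (simple b) (simple a)

  SimplyLaced : Set
  SimplyLaced = ∀ a b → a ≢ b → bonds a b ℤ.≤ ℤ.1ℤ

  _∋ᵛ_ : Subset size → Carrierᴹ → Set ℓm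
  I ∋ᵛ x = ∃[ γ ] γ ∈ I × root γ ≈ᴹ x

  IsStarIdeal : Subset size → Set ℓm
  IsStarIdeal I =
    ∃[ a₁ ] ∃[ a₂ ] ∃[ a₃ ] ∃[ a₄ ]
      (a₁ ≢ a₂ × a₁ ≢ a₃ × a₁ ≢ a₄ × a₂ ≢ a₃ × a₂ ≢ a₄ × a₃ ≢ a₄)
    × I ∋ᵛ (α a₁ +ᴹ α a₂ +ᴹ α a₃)
    × I ∋ᵛ (α a₁ +ᴹ α a₂ +ᴹ α a₄)
    × I ∋ᵛ (α a₂ +ᴹ α a₃ +ᴹ α a₄)

record TypeF₄ {K : OrderedField c ℓ₁ ℓ₂} {E : EuclideanSpace K m ℓm} {Φ : RootSystem E}
              (Δ : Base Φ) : Set (ℓ₁ ⊔ ℓ₂ ⊔ ℓm) where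
  private module K = OrderedField K
  open EuclideanSpace E
  open RootSystem Φ
  open Base Δ

  field
    labelling : Fin 4 ↔ Fin rank

  a₁ : Fin rank
  a₁ = Inverse.to labelling 0F

  a₂ : Fin rank
  a₂ = Inverse.to labelling 1F

  a₃ : Fin rank
  a₃ = Inverse.to labelling 2F

  a₄ : Fin rank
  a₄ = Inverse.to labelling 3F

  α₁ : Carrierᴹ
  α₁ = α a₁

  α₂ : Carrierᴹ
  α₂ = α a₂

  α₃ : Carrierᴹ
  α₃ = α a₃

  α₄ : Carrierᴹ
  α₄ = α a₄

  field
    bonds₁₂ : bonds a₁ a₂ ≡ + 1
    bonds₂₃ : bonds a₂ a₃ ≡ + 2
    bonds₃₄ : bonds a₃ a₄ ≡ + 1
    bonds₁₃ : bonds a₁ a₃ ≡ + 0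
    bonds₁₄ : bonds a₁ a₄ ≡ + 0
    bonds₂₄ : bonds a₂ a₄ ≡ + 0
    short   : ⟪ α₁ , α₁ ⟫ K.≈ ⟪ α₂ , α₂ ⟫
    long    : ⟪ α₃ , α₃ ⟫ K.≈ ⟪ α₄ , α₄ ⟫
    short<long : ⟪ α₂ , α₂ ⟫ K.< ⟪ α₃ , α₃ ⟫

  η₁ η₂ η₃ : Carrierᴹ
  η₁ = α₁ +ᴹ (α₂ +ᴹ α₂) +ᴹ α₃
  η₂ = α₁ +ᴹ α₂ +ᴹ α₃ +ᴹ α₄
  η₃ = (α₂ +ᴹ α₂) +ᴹ α₃ +ᴹ α₄

  Î : Fin size → Set ℓm
  Î γ = Positive γ
      × ∃[ η ] Positive η × (root η ≈ᴹ η₁ ⊎ root η ≈ᴹ η₂ ⊎ root η ≈ᴹ η₃) × γ ≼ η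

{-# OPTIONS --safe #-}

-- A proper subsystem whose planes contain no roots outside it meets I in a 2-closed set, and this
-- set is not a flat as soon as its span contains a root of I outside the subsystem. For a star
-- ideal the four simple roots span a D₄ with centre α₂, and the subsystem is the 4A₁ with positive
-- roots α₁+α₂+α₃, α₁+α₂+α₄, α₂+α₃+α₄, α₂. In type F₄ it is an A₂ × A₂ with one factor long and the
-- other short, four of whose positive roots lie in Î and are linearly independent. In both cases
-- α₁ is the root that violates flatness.
--
-- The lists of positive roots of D₄ and F₄ are complete because a positive root that is not simple
-- can be reflected to a positive root of smaller height.

module Submission where

open import Defs
open import Algebra.Bundles using (CommutativeMonoid)
import Algebra.Properties.CommutativeMonoid.Sum as CommutativeMonoidSum
import Algebra.Properties.Ring as RingProperties
import Algebra.Properties.Semiring.Mult as SemiringMult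
import Algebra.Properties.Semiring.Sum as SemiringSum
open import Data.Bool.Base using (if_then_else_)
open import Data.Fin.Base using (Fin; zero; suc; toℕ)
open import Data.Fin.Patterns using (0F; 1F; 2F; 3F; 4F; 5F)
open import Data.Fin.Properties as Fin using (any?; all?)
open import Data.Fin.Subset using (Subset; _∈_; _∉_; ⁅_⁆; _∪_)
open import Data.Fin.Subset.Properties using (x∈p∪q⁻; x∈⁅y⁆⇒x≡y; _∈?_)
open import Data.Integer.Base as ℤ using (ℤ; +_; -[1+_]; 0ℤ; 1ℤ; -1ℤ)
import Data.Integer.Properties as ℤ
open import Data.Integer.Tactic.RingSolver using (solve-∀)
open import Data.List.Base using (List; []; _∷_; foldr)
import Data.List.Membership.DecPropositional as DecMembership
import Data.List.Membership.Propositional as List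
open import Data.List.Relation.Unary.All as All using (All)
open import Data.Nat.Base as ℕ using (ℕ; s≤s)
import Data.Nat.Properties as ℕ
open import Data.Product.Base using (_×_; _,_; ∃-syntax; proj₁; proj₂)
open import Data.Sum.Base using (_⊎_; inj₁; inj₂; [_,_]′)
open import Data.Vec.Base using (Vec; []; _∷_; lookup; tabulate)
open import Data.Vec.Properties
  using (lookup∘tabulate; tabulate∘lookup; tabulate-cong; []=⇒lookup; lookup⇒[]=; ≡-dec)
open import Data.Vec.Relation.Unary.All using ([]; _∷_)
open import Data.Vec.Relation.Unary.AllPairs using ([]; _∷_)
open import Data.Vec.Relation.Unary.Unique.Propositional.Properties using (lookup-injective)
open import Function.Base using (_∘_)
open import Function.Bundles using (_⇔_; mk⇔; Equivalence; Inverse)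
open import Relation.Binary.PropositionalEquality as ≡ using (_≡_; _≢_)
import Relation.Binary.Reasoning.Setoid as SetoidReasoning
open import Relation.Binary.Structures using (IsTotalOrder)
open import Relation.Nullary.Decidable
  using (Dec; yes; no; does; dec-true; decidable-stable; from-yes; ¬?; _×-dec_; _⊎-dec_; _→-dec_)
open import Relation.Nullary.Negation.Core using (¬_; contradiction)

-- The subsystems are closed under planes for reasons of rank two. The roots in a plane spanned by
-- two roots of D₄ form A₁ × A₁ or A₂, so two orthogonal roots are, up to sign, alone in their
-- plane. In F₄ the type B₂ also occurs, but orthogonal roots of B₂ have equal length: a long root
-- and an orthogonal short root are again alone, and a plane containing an A₂ contains nothing more.
-- This is why the two A₂ factors must differ in length. The subsystems span root lattices of index
-- 2 and 3, so 2α₁ and 3α₁, but not α₁, are integral combinations of their roots. Equality of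
-- scalars is not assumed decidable, hence neither is membership in a span. Questions about roots
-- are moved to their integer coefficient vectors and settled there by finite decision procedures;
-- lying in a plane is tested by integer functionals. A star ideal only supplies three roots, so the
-- diagram on its four simple roots has to be recovered before any list of roots can be used.

private
  module List∈? {n} = DecMembership (≡-dec {n = n} ℤ._≟_)

module Σℤ = SemiringSum ℤ.+-*-semiring
open Σℤ using () renaming (sum to sumℤ)

-- Extension along an injection, and sums supported on its image

extend : ∀ {x} {X : Set x} {p n} → (Fin p → Fin n) → X → (Fin p → X) → Fin n → X
extend a d f b with any? (λ j → a j Fin.≟ b)
... | yes (j , _) = f j
... | no  _       = d

module _ {x} {X : Set x} {p n} (a : Fin p → Fin n) (d : X) (f : Fin p → X) where

  extend-image : (∀ i j → a i ≡ a j → i ≡ j) → ∀ j → extend a d f (a j) ≡ f j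
  extend-image a-injective j with any? (λ i → a i Fin.≟ a j)
  ... | yes (i , ai≡aj) = ≡.cong f (a-injective i j ai≡aj)
  ... | no  ∄i          = contradiction (j , ≡.refl) ∄i

  extend-outside : ∀ b → (∀ j → a j ≢ b) → extend a d f b ≡ d
  extend-outside b b∉a with any? (λ i → a i Fin.≟ b)
  ... | yes (i , ai≡b) = contradiction ai≡b (b∉a i)
  ... | no  _          = ≡.refl

module SumOverImage {c ℓ} (M : CommutativeMonoid c ℓ) where
  open CommutativeMonoid M
  open CommutativeMonoidSum M
  open SetoidReasoning setoid

  sum-zero : ∀ {n} (f : Fin n → Carrier) → (∀ i → f i ≈ ε) → sum f ≈ ε
  sum-zero {n} f f≈ε = trans (sum-cong-≋ f≈ε) (sum-replicate-zero n)

  private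
    -- Overwriting a value by `ε`, instead of deleting its index, keeps the index type fixed, so
    -- that `a ∘ suc` is still a valid family in the induction of `sum-image`.
    eraseAt : ∀ {n} → Fin n → (Fin n → Carrier) → Fin n → Carrier
    eraseAt i f j with i Fin.≟ j
    ... | yes _ = ε
    ... | no  _ = f j

    eraseAt-≢ : ∀ {n} (i : Fin n) f {j} → i ≢ j → eraseAt i f j ≡ f j
    eraseAt-≢ i f {j} i≢j with i Fin.≟ j
    ... | yes i≡j = contradiction i≡j i≢j
    ... | no _    = ≡.refl

    sum-eraseAt : ∀ {n} (i : Fin n) f → sum f ≈ f i ∙ sum (eraseAt i f)
    sum-eraseAt zero f = ∙-congˡ (sym (identityˡ _))
    sum-eraseAt (suc i) f = begin
      f zero ∙ sum (f ∘ suc)                                      ≈⟨ ∙-congˡ (sum-eraseAt i (f ∘ suc)) ⟩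
      f zero ∙ (f (suc i) ∙ sum (eraseAt i (f ∘ suc)))            ≈⟨ assoc _ _ _ ⟨
      f zero ∙ f (suc i) ∙ sum (eraseAt i (f ∘ suc))              ≈⟨ ∙-congʳ (comm _ _) ⟩
      f (suc i) ∙ f zero ∙ sum (eraseAt i (f ∘ suc))              ≈⟨ assoc _ _ _ ⟩
      f (suc i) ∙ (f zero ∙ sum (eraseAt i (f ∘ suc)))            ≈⟨ ∙-congˡ (∙-congˡ (sum-cong-≋ tail≈)) ⟩
      f (suc i) ∙ (f zero ∙ sum (eraseAt (suc i) f ∘ suc))        ∎
      where
      tail≈ : ∀ j → eraseAt i (f ∘ suc) j ≈ eraseAt (suc i) f (suc j)
      tail≈ j with i Fin.≟ j
      ... | yes _ = refl
      ... | no _  = refl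

  sum-image : ∀ {p n} (a : Fin p → Fin n) → (∀ i j → a i ≡ a j → i ≡ j) →
              (f : Fin n → Carrier) → (∀ b → (∀ j → a j ≢ b) → f b ≈ ε) →
              sum f ≈ sum (f ∘ a)
  sum-image {ℕ.zero}  a a-injective f f≈ε = sum-zero f (λ b → f≈ε b (λ ()))
  sum-image {ℕ.suc p} a a-injective f f≈ε = begin
    sum f                                           ≈⟨ sum-eraseAt (a zero) f ⟩
    f (a zero) ∙ sum (eraseAt (a zero) f)           ≈⟨ ∙-congˡ (sum-image (a ∘ suc) a∘suc-injective _ erased≈ε) ⟩
    f (a zero) ∙ sum (eraseAt (a zero) f ∘ a ∘ suc) ≈⟨ ∙-congˡ (sum-cong-≋ λ j → reflexive (eraseAt-≢ (a zero) f (a0≢ j))) ⟩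
    f (a zero) ∙ sum (f ∘ a ∘ suc)                  ∎
    where
    a∘suc-injective : ∀ i j → a (suc i) ≡ a (suc j) → i ≡ j
    a∘suc-injective i j eq = Fin.suc-injective (a-injective _ _ eq)

    a0≢ : ∀ j → a zero ≢ a (suc j)
    a0≢ j eq with a-injective _ _ eq
    ... | ()

    erased≈ε : ∀ b → (∀ j → a (suc j) ≢ b) → eraseAt (a zero) f b ≈ ε
    erased≈ε b b∉ with a zero Fin.≟ b
    ... | yes _ = refl
    ... | no a0≢b = f≈ε b λ { zero → a0≢b ; (suc j) → b∉ j }

-- The integers inside an ordered field

module OrderedFieldProperties {c ℓ₁ ℓ₂} (K : OrderedField c ℓ₁ ℓ₂) where
  open OrderedField K hiding (zero)
  open IsTotalOrder isTotalOrder using (total; antisym; ≤-respˡ-≈; ≤-respʳ-≈)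
    renaming (refl to ≤-refl; trans to ≤-trans)
  open RingProperties ring
  open SemiringMult semiring using (×-homo-+) renaming (_×_ to _⋆_)
  open SemiringSum semiring using (sum)
  open SetoidReasoning setoid

  +-swap-suc : ∀ x y → x + - y ≈ (1# + x) + - (1# + y)
  +-swap-suc x y = begin
    x + - y                        ≈⟨ +-congʳ (+-identityʳ x) ⟨
    x + 0# + - y                   ≈⟨ +-congʳ (+-congˡ (-‿inverseʳ 1#)) ⟨
    x + (1# + - 1#) + - y          ≈⟨ +-congʳ (+-assoc _ _ _) ⟨
    x + 1# + - 1# + - y            ≈⟨ +-congʳ (+-congʳ (+-comm _ _)) ⟩
    1# + x + - 1# + - y            ≈⟨ +-assoc _ _ _ ⟩
    1# + x + (- 1# + - y)          ≈⟨ +-congˡ (-‿+-comm 1# y) ⟩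
    1# + x + - (1# + y)            ∎

  fromℤ-⊖ : ∀ m n → fromℤ (m ℤ.⊖ n) ≈ m ⋆ 1# + - (n ⋆ 1#)
  fromℤ-⊖ ℕ.zero    ℕ.zero    = sym (-‿inverseʳ 0#)
  fromℤ-⊖ ℕ.zero    (ℕ.suc n) = sym (+-identityˡ _)
  fromℤ-⊖ (ℕ.suc m) ℕ.zero    = sym (trans (+-congˡ -0#≈0#) (+-identityʳ _))
  fromℤ-⊖ (ℕ.suc m) (ℕ.suc n) = begin
    fromℤ (ℕ.suc m ℤ.⊖ ℕ.suc n)        ≡⟨ ≡.cong fromℤ (ℤ.[1+m]⊖[1+n]≡m⊖n m n) ⟩
    fromℤ (m ℤ.⊖ n)                    ≈⟨ fromℤ-⊖ m n ⟩
    m ⋆ 1# + - (n ⋆ 1#)                ≈⟨ +-swap-suc _ _ ⟩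
    ℕ.suc m ⋆ 1# + - (ℕ.suc n ⋆ 1#)    ∎

  fromℤ-neg : ∀ i → fromℤ (ℤ.- i) ≈ - fromℤ i
  fromℤ-neg (+ ℕ.zero)  = sym -0#≈0#
  fromℤ-neg (+ ℕ.suc n) = refl
  fromℤ-neg -[1+ n ]    = sym (-‿involutive _)

  fromℤ-+ : ∀ i j → fromℤ (i ℤ.+ j) ≈ fromℤ i + fromℤ j
  fromℤ-+ (+ m)    (+ n)    = ×-homo-+ 1# m n
  fromℤ-+ (+ m)    -[1+ n ] = fromℤ-⊖ m (ℕ.suc n)
  fromℤ-+ -[1+ m ] (+ n)    = trans (fromℤ-⊖ n (ℕ.suc m)) (+-comm _ _)
  fromℤ-+ -[1+ m ] -[1+ n ] = begin
    - (1# + (1# + (m ℕ.+ n) ⋆ 1#))        ≈⟨ -‿cong (+-congˡ (+-congˡ (×-homo-+ 1# m n))) ⟩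
    - (1# + (1# + (m ⋆ 1# + n ⋆ 1#)))     ≈⟨ -‿cong (+-congˡ (+-assoc _ _ _)) ⟨
    - (1# + (1# + m ⋆ 1# + n ⋆ 1#))       ≈⟨ -‿cong (+-congˡ (+-comm _ _)) ⟩
    - (1# + (n ⋆ 1# + (1# + m ⋆ 1#)))     ≈⟨ -‿cong (+-assoc _ _ _) ⟨
    - (1# + n ⋆ 1# + (1# + m ⋆ 1#))       ≈⟨ -‿cong (+-comm _ _) ⟩
    - ((1# + m ⋆ 1#) + (1# + n ⋆ 1#))     ≈⟨ -‿+-comm _ _ ⟨
    - (1# + m ⋆ 1#) + - (1# + n ⋆ 1#)     ∎

  fromℤ-1 : fromℤ 1ℤ ≈ 1#
  fromℤ-1 = +-identityʳ 1#

  private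
    fromℤ-+* : ∀ m j → fromℤ (+ m ℤ.* j) ≈ fromℤ (+ m) * fromℤ j
    fromℤ-+* ℕ.zero j = sym (zeroˡ _)
    fromℤ-+* (ℕ.suc m) j = begin
      fromℤ (+ ℕ.suc m ℤ.* j)                  ≡⟨ ≡.cong fromℤ (ℤ.suc-* (+ m) j) ⟩
      fromℤ (j ℤ.+ + m ℤ.* j)                  ≈⟨ fromℤ-+ j (+ m ℤ.* j) ⟩
      fromℤ j + fromℤ (+ m ℤ.* j)              ≈⟨ +-cong (sym (*-identityˡ _)) (fromℤ-+* m j) ⟩
      1# * fromℤ j + fromℤ (+ m) * fromℤ j     ≈⟨ distribʳ _ _ _ ⟨
      (1# + fromℤ (+ m)) * fromℤ j             ∎

  fromℤ-* : ∀ i j → fromℤ (i ℤ.* j) ≈ fromℤ i * fromℤ j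
  fromℤ-* (+ m) j = fromℤ-+* m j
  fromℤ-* -[1+ m ] j = begin
    fromℤ (-[1+ m ] ℤ.* j)             ≡⟨ ≡.cong fromℤ (ℤ.neg-distribˡ-* (+ ℕ.suc m) j) ⟨
    fromℤ (ℤ.- (+ ℕ.suc m ℤ.* j))      ≈⟨ fromℤ-neg (+ ℕ.suc m ℤ.* j) ⟩
    - fromℤ (+ ℕ.suc m ℤ.* j)          ≈⟨ -‿cong (fromℤ-+* (ℕ.suc m) j) ⟩
    - (fromℤ (+ ℕ.suc m) * fromℤ j)    ≈⟨ -‿distribˡ-* _ _ ⟩
    - fromℤ (+ ℕ.suc m) * fromℤ j      ∎

  fromℤ-sum : ∀ {n} (f : Fin n → ℤ) → fromℤ (sumℤ f) ≈ sum (fromℤ ∘ f)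
  fromℤ-sum {ℕ.zero}  f = refl
  fromℤ-sum {ℕ.suc n} f = trans (fromℤ-+ (f zero) (sumℤ (f ∘ suc))) (+-congˡ (fromℤ-sum (f ∘ suc)))

  x≤0⇒0≤-x : ∀ {x} → x ≤ 0# → 0# ≤ - x
  x≤0⇒0≤-x {x} x≤0 = ≤-respʳ-≈ (+-identityˡ (- x)) (≤-respˡ-≈ (-‿inverseʳ x) (+-monoˡ-≤ (- x) x≤0))

  0≤-x⇒x≤0 : ∀ {x} → 0# ≤ - x → x ≤ 0#
  0≤-x⇒x≤0 {x} 0≤-x = ≤-respʳ-≈ (-‿inverseˡ x) (≤-respˡ-≈ (+-identityˡ x) (+-monoˡ-≤ x 0≤-x))

  +-mono-≤ : ∀ {x y u v} → x ≤ y → u ≤ v → x + u ≤ y + v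
  +-mono-≤ {x} {y} {u} {v} x≤y u≤v = ≤-trans (+-monoˡ-≤ u x≤y)
    (≤-respʳ-≈ (+-comm v y) (≤-respˡ-≈ (+-comm u y) (+-monoˡ-≤ y u≤v)))

  0≤1 : 0# ≤ 1#
  0≤1 with total 0# 1#
  ... | inj₁ 0≤1 = 0≤1
  ... | inj₂ 1≤0 = ≤-respʳ-≈ (trans (-1*x≈-x (- 1#)) (-‿involutive 1#))
                     (*-nonNegative (x≤0⇒0≤-x 1≤0) (x≤0⇒0≤-x 1≤0))

  0≤n⋆1 : ∀ n → 0# ≤ n ⋆ 1#
  0≤n⋆1 ℕ.zero    = ≤-refl
  0≤n⋆1 (ℕ.suc n) = ≤-respˡ-≈ (+-identityˡ 0#) (+-mono-≤ 0≤1 (0≤n⋆1 n))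

  0≤x∧x+x≤0⇒x≈0 : ∀ {x} → 0# ≤ x → x + x ≤ 0# → x ≈ 0#
  0≤x∧x+x≤0⇒x≈0 {x} 0≤x x+x≤0 = antisym (≤-trans (≤-respˡ-≈ (+-identityˡ x) (+-monoˡ-≤ x 0≤x)) x+x≤0) 0≤x

  -- Characteristic zero: the sum is at least 1, so its vanishing would give 1 ≤ 0.
  [1+n]⋆1≉0 : ∀ n → ¬ ℕ.suc n ⋆ 1# ≈ 0#
  [1+n]⋆1≉0 n eq = 0≉1 (antisym 0≤1
    (≤-respʳ-≈ (trans (+-comm _ _) eq) (≤-respˡ-≈ (+-identityˡ 1#) (+-monoˡ-≤ 1# (0≤n⋆1 n)))))

  fromℤ≈0⇒≡0 : ∀ i → fromℤ i ≈ 0# → i ≡ 0ℤ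
  fromℤ≈0⇒≡0 (+ ℕ.zero)  _  = ≡.refl
  fromℤ≈0⇒≡0 (+ ℕ.suc n) eq = contradiction eq ([1+n]⋆1≉0 n)
  fromℤ≈0⇒≡0 -[1+ n ]    eq = contradiction (trans (sym (-‿involutive _)) (trans (-‿cong eq) -0#≈0#)) ([1+n]⋆1≉0 n)

  fromℤ-- : ∀ i j → fromℤ (i ℤ.- j) ≈ fromℤ i + - fromℤ j
  fromℤ-- i j = trans (fromℤ-+ i (ℤ.- j)) (+-congˡ (fromℤ-neg j))

  fromℤ-injective : ∀ {i j} → fromℤ i ≈ fromℤ j → i ≡ j
  fromℤ-injective {i} {j} eq = ℤ.i-j≡0⇒i≡j i j (fromℤ≈0⇒≡0 (i ℤ.- j) (begin
    fromℤ (i ℤ.- j)       ≈⟨ fromℤ-- i j ⟩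
    fromℤ i + - fromℤ j   ≈⟨ +-congʳ eq ⟩
    fromℤ j + - fromℤ j   ≈⟨ -‿inverseʳ _ ⟩
    0#                    ∎))

  *-cancelʳ-≈ : ∀ {x y s} → ¬ s ≈ 0# → x * s ≈ y * s → x ≈ y
  *-cancelʳ-≈ {x} {y} {s} s≉0 xs≈ys with inverse s s≉0
  ... | s⁻¹ , ss⁻¹≈1 = begin
    x              ≈⟨ *-identityʳ x ⟨
    x * 1#         ≈⟨ *-congˡ ss⁻¹≈1 ⟨
    x * (s * s⁻¹)  ≈⟨ *-assoc _ _ _ ⟨
    x * s * s⁻¹    ≈⟨ *-congʳ xs≈ys ⟩
    y * s * s⁻¹    ≈⟨ *-assoc _ _ _ ⟩
    y * (s * s⁻¹)  ≈⟨ *-congˡ ss⁻¹≈1 ⟩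
    y * 1#         ≈⟨ *-identityʳ y ⟩
    y              ∎

  fromℤ-*-nonPositive : ∀ {i s} → i ℤ.≤ 0ℤ → 0# ≤ s → fromℤ i * s ≤ 0#
  fromℤ-*-nonPositive {i} {s} i≤0 0≤s = 0≤-x⇒x≤0
    (≤-respʳ-≈ (trans (*-congʳ (fromℤ-neg i)) (sym (-‿distribˡ-* _ _)))
      (*-nonNegative (nonNeg (ℤ.neg-mono-≤ i≤0)) 0≤s))
    where
    nonNeg : ∀ {j} → 0ℤ ℤ.≤ j → 0# ≤ fromℤ j
    nonNeg {+ n} _ = 0≤n⋆1 n

  sum-nonPositive : ∀ {n} (f : Fin n → Carrier) → (∀ i → f i ≤ 0#) → sum f ≤ 0#
  sum-nonPositive {ℕ.zero}  f f≤0 = ≤-refl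
  sum-nonPositive {ℕ.suc n} f f≤0 = ≤-respʳ-≈ (+-identityˡ 0#) (+-mono-≤ (f≤0 zero) (sum-nonPositive (f ∘ suc) (f≤0 ∘ suc)))

unit : ∀ {n} → Fin n → Fin n → ℤ
unit i j = if does (i Fin.≟ j) then 1ℤ else 0ℤ

unit-≡ : ∀ {n} (i : Fin n) → unit i i ≡ 1ℤ
unit-≡ i with i Fin.≟ i
... | yes _  = ≡.refl
... | no i≢i = contradiction ≡.refl i≢i

unit-≢ : ∀ {n} {i j : Fin n} → i ≢ j → unit i j ≡ 0ℤ
unit-≢ {i = i} {j} i≢j with i Fin.≟ j
... | yes i≡j = contradiction i≡j i≢j
... | no _    = ≡.refl

-- Linear combinations and their inner products

module EuclideanSpaceProperties {c ℓ₁ ℓ₂ m ℓm} {K : OrderedField c ℓ₁ ℓ₂} (E : EuclideanSpace K m ℓm) where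
  private module K where
    open OrderedField K hiding (zero) public
    open OrderedFieldProperties K public
    open SemiringSum semiring public
  open EuclideanSpace E
  open CommutativeMonoidSum +ᴹ-commutativeMonoid
  open SumOverImage +ᴹ-commutativeMonoid
  open SetoidReasoning ≈ᴹ-setoid

  linComb-cong : ∀ {n} {k l : Fin n → K.Carrier} (v : Fin n → Carrierᴹ) →
                 (∀ i → k i K.≈ l i) → linComb k v ≈ᴹ linComb l v
  linComb-cong v k≈l = sum-cong-≋ (λ i → *ₗ-congʳ (k≈l i))

  linComb-congʳ : ∀ {n} (k : Fin n → K.Carrier) {u v : Fin n → Carrierᴹ} →
                  (∀ i → u i ≈ᴹ v i) → linComb k u ≈ᴹ linComb k v
  linComb-congʳ k u≈v = sum-cong-≋ (λ i → *ₗ-congˡ (u≈v i))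

  linComb-+ : ∀ {n} (k l : Fin n → K.Carrier) (v : Fin n → Carrierᴹ) →
              linComb (λ i → k i K.+ l i) v ≈ᴹ linComb k v +ᴹ linComb l v
  linComb-+ k l v = ≈ᴹ-trans (sum-cong-≋ (λ i → *ₗ-distribʳ (v i) (k i) (l i))) (∑-distrib-+ (λ i → k i *ₗ v i) (λ i → l i *ₗ v i))

  linComb-* : ∀ {n} x (k : Fin n → K.Carrier) (v : Fin n → Carrierᴹ) →
              linComb (λ i → x K.* k i) v ≈ᴹ x *ₗ linComb k v
  linComb-* {ℕ.zero}  x k v = ≈ᴹ-sym (*ₗ-zeroʳ x)
  linComb-* {ℕ.suc n} x k v = ≈ᴹ-trans (+ᴹ-cong (*ₗ-assoc x (k zero) (v zero)) (linComb-* x (k ∘ suc) (v ∘ suc)))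
                                       (≈ᴹ-sym (*ₗ-distribˡ x _ _))

  linComb-neg : ∀ {n} (k : Fin n → K.Carrier) (v : Fin n → Carrierᴹ) →
                linComb (λ i → K.- k i) v ≈ᴹ -ᴹ linComb k v
  linComb-neg k v = begin
    linComb (λ i → K.- k i) v                   ≈⟨ uniqueʳ‿-ᴹ (linComb k v) _ (begin
      linComb k v +ᴹ linComb (λ i → K.- k i) v  ≈⟨ linComb-+ k _ v ⟨
      linComb (λ i → k i K.+ K.- k i) v         ≈⟨ sum-zero _ (λ i → ≈ᴹ-trans (*ₗ-congʳ (K.-‿inverseʳ (k i))) (*ₗ-zeroˡ (v i))) ⟩
      0ᴹ                                        ∎) ⟩
    -ᴹ linComb k v                              ∎

  linComb-image : ∀ {p n} (a : Fin p → Fin n) → (∀ i j → a i ≡ a j → i ≡ j) →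
                  ∀ k (v : Fin n → Carrierᴹ) → (∀ b → (∀ j → a j ≢ b) → k b K.≈ K.0#) →
                  linComb k v ≈ᴹ linComb (k ∘ a) (v ∘ a)
  linComb-image a a-injective k v k≈0 = sum-image a a-injective _
    (λ b b∉a → ≈ᴹ-trans (*ₗ-congʳ (k≈0 b b∉a)) (*ₗ-zeroˡ (v b)))

  linComb-extend : ∀ {p n} (a : Fin p → Fin n) → (∀ i j → a i ≡ a j → i ≡ j) →
                   ∀ k (v : Fin n → Carrierᴹ) →
                   linComb (extend a K.0# k) v ≈ᴹ linComb k (v ∘ a)
  linComb-extend a a-injective k v = ≈ᴹ-trans
    (linComb-image a a-injective _ v (λ b b∉a → K.reflexive (extend-outside a K.0# k b b∉a)))
    (linComb-cong (v ∘ a) (λ j → K.reflexive (extend-image a K.0# k a-injective j)))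

  linComb-singleton : ∀ {n} i k (v : Fin n → Carrierᴹ) → (∀ j → i ≢ j → k j K.≈ K.0#) →
                      linComb k v ≈ᴹ k i *ₗ v i
  linComb-singleton i k v k≈0 = ≈ᴹ-trans
    (linComb-image {1} (λ _ → i) (λ { zero zero _ → ≡.refl }) k v (λ b i≢b → k≈0 b (i≢b zero)))
    (+ᴹ-identityʳ _)

  linComb-linComb : ∀ {q n} (k : Fin q → K.Carrier) (l : Fin q → Fin n → K.Carrier) (v : Fin n → Carrierᴹ) →
                    linComb k (λ t → linComb (l t) v) ≈ᴹ linComb (λ j → K.sum (λ t → k t K.* l t j)) v
  linComb-linComb {ℕ.zero}  k l v = ≈ᴹ-sym (sum-zero _ (λ i → *ₗ-zeroˡ (v i)))
  linComb-linComb {ℕ.suc q} k l v = begin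
    k zero *ₗ linComb (l zero) v +ᴹ linComb (k ∘ suc) (λ t → linComb (l (suc t)) v)
      ≈⟨ +ᴹ-cong (≈ᴹ-sym (linComb-* (k zero) (l zero) v)) (linComb-linComb (k ∘ suc) (l ∘ suc) v) ⟩
    linComb (λ j → k zero K.* l zero j) v +ᴹ linComb (λ j → K.sum (λ t → k (suc t) K.* l (suc t) j)) v
      ≈⟨ linComb-+ _ _ v ⟨
    linComb (λ j → K.sum (λ t → k t K.* l t j)) v ∎

  ⟪⟫-zeroˡ : ∀ w → ⟪ 0ᴹ , w ⟫ K.≈ K.0#
  ⟪⟫-zeroˡ w = K.trans (⟪⟫-cong (≈ᴹ-sym (*ₗ-zeroˡ 0ᴹ)) ≈ᴹ-refl) (K.trans (⟪⟫-*ˡ K.0# 0ᴹ w) (K.zeroˡ _))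

  ⟪⟫-linComb : ∀ {n} (k : Fin n → K.Carrier) (v : Fin n → Carrierᴹ) w →
               ⟪ linComb k v , w ⟫ K.≈ K.sum (λ i → k i K.* ⟪ v i , w ⟫)
  ⟪⟫-linComb {ℕ.zero}  k v w = ⟪⟫-zeroˡ w
  ⟪⟫-linComb {ℕ.suc n} k v w = K.trans (⟪⟫-+ˡ _ _ w) (K.+-cong (⟪⟫-*ˡ _ _ w) (⟪⟫-linComb (k ∘ suc) (v ∘ suc) w))

  -- Doubled because `cartan-def` speaks of 2⟪β,α⟫; working with this quantity throughout avoids
  -- dividing by 2.
  twice-⟪⟫-linComb : ∀ {n} (k : Fin n → K.Carrier) (v : Fin n → Carrierᴹ) w →
    ⟪ linComb k v , w ⟫ K.+ ⟪ linComb k v , w ⟫ K.≈ K.sum (λ i → k i K.* (⟪ v i , w ⟫ K.+ ⟪ v i , w ⟫))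
  twice-⟪⟫-linComb k v w = K.trans (K.+-cong (⟪⟫-linComb k v w) (⟪⟫-linComb k v w))
    (K.trans (K.sym (K.∑-distrib-+ f f)) (K.sum-cong-≋ (λ i → K.sym (K.distribˡ (k i) ⟪ v i , w ⟫ ⟪ v i , w ⟫))))
    where f = λ i → k i K.* ⟪ v i , w ⟫

-- Simple reflections in integer coordinates

sumℤ-linear : ∀ {n} (f g : Fin n → ℤ) k → sumℤ (λ j → f j ℤ.- k ℤ.* g j) ≡ sumℤ f ℤ.- k ℤ.* sumℤ g
sumℤ-linear {ℕ.zero}  f g k = ≡.cong (λ x → 0ℤ ℤ.- x) (≡.sym (ℤ.*-zeroʳ k))
sumℤ-linear {ℕ.suc n} f g k = ≡.trans (≡.cong (λ s → (f zero ℤ.- k ℤ.* g zero) ℤ.+ s) (sumℤ-linear (f ∘ suc) (g ∘ suc) k))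
  (rearrange (f zero) k (g zero) (sumℤ (f ∘ suc)) (sumℤ (g ∘ suc)))
  where
  rearrange : ∀ x k y s t → (x ℤ.- k ℤ.* y) ℤ.+ (s ℤ.- k ℤ.* t) ≡ (x ℤ.+ s) ℤ.- k ℤ.* (y ℤ.+ t)
  rearrange = solve-∀

sumℤ-mono-≤ : ∀ {n} {f g : Fin n → ℤ} → (∀ i → f i ℤ.≤ g i) → sumℤ f ℤ.≤ sumℤ g
sumℤ-mono-≤ {ℕ.zero}  f≤g = ℤ.≤-refl
sumℤ-mono-≤ {ℕ.suc n} f≤g = ℤ.+-mono-≤ (f≤g zero) (sumℤ-mono-≤ (f≤g ∘ suc))

sumℤ-nonNegative : ∀ {n} {f : Fin n → ℤ} → (∀ i → 0ℤ ℤ.≤ f i) → 0ℤ ℤ.≤ sumℤ f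
sumℤ-nonNegative {ℕ.zero}  0≤f = ℤ.≤-refl
sumℤ-nonNegative {ℕ.suc n} 0≤f = ℤ.+-mono-≤ (0≤f zero) (sumℤ-nonNegative (0≤f ∘ suc))

sumℤ-singleton : ∀ {n} i (f : Fin n → ℤ) → (∀ j → i ≢ j → f j ≡ 0ℤ) → sumℤ f ≡ f i
sumℤ-singleton i f f≡0 = ≡.trans
  (SumOverImage.sum-image ℤ.+-0-commutativeMonoid {1} (λ _ → i) (λ { zero zero _ → ≡.refl }) f (λ b i≢b → f≡0 b (i≢b zero)))
  (ℤ.+-identityʳ (f i))

module _ {p} (C : Fin p → Fin p → ℤ) where

  -- For a Cartan matrix `C` this is ⟨v,αᵢ^∨⟩ in simple-root coordinates, and `reflect i` below is
  -- the simple reflection sᵢ.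
  pairing : (Fin p → ℤ) → Fin p → ℤ
  pairing v i = sumℤ (λ j → v j ℤ.* C j i)

  reflect : Fin p → (Fin p → ℤ) → Fin p → ℤ
  reflect i v j = v j ℤ.- pairing v i ℤ.* unit i j

  pairing-cong : ∀ {u v} → (∀ j → u j ≡ v j) → ∀ i → pairing u i ≡ pairing v i
  pairing-cong {u} {v} u≗v i = Σℤ.sum-cong-≗ {x = λ j → u j ℤ.* C j i} {λ j → v j ℤ.* C j i} (λ j → ≡.cong (ℤ._* C j i) (u≗v j))

  reflect-cong : ∀ {u v} i → (∀ j → u j ≡ v j) → ∀ j → reflect i u j ≡ reflect i v j
  reflect-cong i u≗v j = ≡.cong₂ (λ x k → x ℤ.- k ℤ.* unit i j) (u≗v j) (pairing-cong u≗v i)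

  sumℤ-reflect : ∀ i v → sumℤ (reflect i v) ≡ sumℤ v ℤ.- pairing v i
  sumℤ-reflect i v = ≡.trans (sumℤ-linear v (unit i) (pairing v i))
    (≡.cong (λ x → sumℤ v ℤ.- x) (≡.trans (≡.cong (pairing v i ℤ.*_) Σunit) (ℤ.*-identityʳ _)))
    where
    Σunit : sumℤ (unit i) ≡ 1ℤ
    Σunit = ≡.trans (sumℤ-singleton i (unit i) (λ j → unit-≢)) (unit-≡ i)

  pairing-reflect : ∀ i v → C i i ≡ + 2 → pairing (reflect i v) i ≡ ℤ.- pairing v i
  pairing-reflect i v Cii≡2 = begin
    sumℤ (λ j → (v j ℤ.- k ℤ.* unit i j) ℤ.* C j i)
      ≡⟨ Σℤ.sum-cong-≗ {x = λ j → (v j ℤ.- k ℤ.* unit i j) ℤ.* C j i}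
           (λ j → distrib (v j) k (unit i j) (C j i)) ⟩
    sumℤ (λ j → v j ℤ.* C j i ℤ.- k ℤ.* (unit i j ℤ.* C j i))
      ≡⟨ sumℤ-linear (λ j → v j ℤ.* C j i) (λ j → unit i j ℤ.* C j i) k ⟩
    k ℤ.- k ℤ.* sumℤ (λ j → unit i j ℤ.* C j i)
      ≡⟨ ≡.cong (λ s → k ℤ.- k ℤ.* s) (sumℤ-singleton i (λ j → unit i j ℤ.* C j i) (λ j i≢j → ≡.cong (ℤ._* C j i) (unit-≢ i≢j))) ⟩
    k ℤ.- k ℤ.* (unit i i ℤ.* C i i)
      ≡⟨ ≡.cong₂ (λ x y → k ℤ.- k ℤ.* (x ℤ.* y)) (unit-≡ i) Cii≡2 ⟩
    k ℤ.- k ℤ.* + 2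
      ≡⟨ collect k ⟩
    ℤ.- k ∎
    where
    open ≡.≡-Reasoning
    k = pairing v i
    distrib : ∀ x k u c → (x ℤ.- k ℤ.* u) ℤ.* c ≡ x ℤ.* c ℤ.- k ℤ.* (u ℤ.* c)
    distrib = solve-∀
    collect : ∀ k → k ℤ.- k ℤ.* + 2 ≡ ℤ.- k
    collect = solve-∀

  reflect-involutive : ∀ i v → C i i ≡ + 2 → ∀ j → reflect i (reflect i v) j ≡ v j
  reflect-involutive i v Cii≡2 j = ≡.trans
    (≡.cong (λ k → (v j ℤ.- pairing v i ℤ.* unit i j) ℤ.- k ℤ.* unit i j) (pairing-reflect i v Cii≡2))
    (cancel (v j) (pairing v i) (unit i j))
    where
    cancel : ∀ x k u → (x ℤ.- k ℤ.* u) ℤ.- ℤ.- k ℤ.* u ≡ x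
    cancel = solve-∀

  reflectSimple : List (Fin p) → Fin p → Vec ℤ p
  reflectSimple w i = foldr (λ k u → tabulate (reflect k (lookup u))) (tabulate (unit i)) w

  -- Only nonnegative images are required to stay in the list, because sᵢ sends αᵢ to -αᵢ.
  ClosedUnderReflections : List (Vec ℤ p) → Set
  ClosedUnderReflections L =
      (∀ i → tabulate (unit i) List.∈ L)
    × (∀ i → All (λ u → (∀ j → 0ℤ ℤ.≤ reflect i (lookup u) j) → tabulate (reflect i (lookup u)) List.∈ L) L)

  closedUnderReflections? : ∀ L → Dec (ClosedUnderReflections L)
  closedUnderReflections? L =
      all? (λ i → tabulate (unit i) List∈?.∈? L)
    ×-dec all? (λ i → All.all? (λ u → all? (λ j → 0ℤ ℤ.≤? reflect i (lookup u) j) →-dec (tabulate (reflect i (lookup u)) List∈?.∈? L)) L)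

-- Roots in the span of a subfamily of the simple roots with Cartan matrix `C`

module SubBase {c ℓ₁ ℓ₂ m ℓm} {K : OrderedField c ℓ₁ ℓ₂} {E : EuclideanSpace K m ℓm}
               {Φ : RootSystem E} (Δ : Base Φ)
               {p} (a : Fin p → Fin (Base.rank Δ)) (a-injective : ∀ i j → a i ≡ a j → i ≡ j)
               (C : Fin p → Fin p → ℤ)
               (cartan≡C : ∀ j i → RootSystem.cartan Φ (Base.simple Δ (a j)) (Base.simple Δ (a i)) ≡ C j i) where
  private module K where
    open OrderedField K hiding (zero) public
    open OrderedFieldProperties K public
    open IsTotalOrder isTotalOrder public using (antisym; ≤-respˡ-≈; ≤-respʳ-≈)
    open SemiringSum semiring public
    open RingProperties ring public
  open EuclideanSpace E
  open EuclideanSpaceProperties E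
  open RootSystem Φ
  open Base Δ

  lin : (Fin p → K.Carrier) → Carrierᴹ
  lin k = linComb k (α ∘ a)

  infix 4 _expands_ _represents_

  -- A record rather than a synonym: once `lin (K.fromℤ ∘ v)` is unfolded, `v` can no longer be read
  -- off, and it could not stay implicit.
  record _expands_ (v : Fin p → ℤ) (x : Carrierᴹ) : Set ℓm where
    constructor by
    field
      expansion : x ≈ᴹ lin (K.fromℤ ∘ v)
  open _expands_ public

  _represents_ : (Fin p → ℤ) → Fin size → Set ℓm
  v represents γ = v expands root γ

  expands-resp-≈ : ∀ {v x y} → x ≈ᴹ y → v expands y → v expands x
  expands-resp-≈ x≈y v∼y = by (≈ᴹ-trans x≈y (expansion v∼y))

  expands-cong : ∀ {x u v} → (∀ j → u j ≡ v j) → u expands x → v expands x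
  expands-cong u≗v u∼x = by (≈ᴹ-trans (expansion u∼x) (linComb-cong (α ∘ a) (λ j → K.reflexive (≡.cong K.fromℤ (u≗v j)))))

  expands-+ : ∀ {x y u v} → u expands x → v expands y → (λ j → u j ℤ.+ v j) expands (x +ᴹ y)
  expands-+ {u = u} {v} u∼x v∼y = by (≈ᴹ-trans (+ᴹ-cong (expansion u∼x) (expansion v∼y)) (≈ᴹ-sym (≈ᴹ-trans
    (linComb-cong (α ∘ a) (λ j → K.fromℤ-+ (u j) (v j))) (linComb-+ _ _ (α ∘ a)))))

  linComb-α-injective : ∀ k l → linComb k α ≈ᴹ linComb l α → ∀ b → k b K.≈ l b
  linComb-α-injective k l eq b = K.x∙y⁻¹≈ε⇒x≈y (k b) (l b) k-l≈0
    where
    k-l≈0 : k b K.+ K.- l b K.≈ K.0#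
    k-l≈0 = independent (λ b → k b K.+ K.- l b)
      (≈ᴹ-trans (linComb-+ k _ α) (≈ᴹ-trans (+ᴹ-cong eq (linComb-neg l α)) (-ᴹ‿inverseʳ _))) b

  module _ {γ k} (γ≈k : root γ ≈ᴹ lin k) where
    private
      coeff≈ : ∀ b → K.fromℤ (coeff γ b) K.≈ extend a K.0# k b
      coeff≈ = linComb-α-injective _ _
        (≈ᴹ-trans (≈ᴹ-sym (coeff-def γ)) (≈ᴹ-trans γ≈k (≈ᴹ-sym (linComb-extend a a-injective k α))))

    -- The `k` are arbitrary scalars, but independence of the simple roots forces them to equal the
    -- integers `coeff γ` on the subfamily and makes `coeff γ` vanish off it. Here a root in a span
    -- turns into an integer vector.
    lin-coeff : ∀ j → K.fromℤ (coeff γ (a j)) K.≈ k j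
    lin-coeff j = K.trans (coeff≈ (a j)) (K.reflexive (extend-image a K.0# k a-injective j))

    lin-outside : ∀ b → (∀ j → a j ≢ b) → coeff γ b ≡ 0ℤ
    lin-outside b b∉a = K.fromℤ≈0⇒≡0 _ (K.trans (coeff≈ b) (K.reflexive (extend-outside a K.0# k b b∉a)))

    lin-represents : coeff γ ∘ a represents γ
    lin-represents = by (≈ᴹ-trans γ≈k (linComb-cong (α ∘ a) (λ j → K.sym (lin-coeff j))))

  represents-coeff : ∀ {γ v} → v represents γ → ∀ j → coeff γ (a j) ≡ v j
  represents-coeff v∼γ j = K.fromℤ-injective (lin-coeff (expansion v∼γ) j)

  represents-injective : ∀ {β γ u v} → u represents β → v represents γ → (∀ j → u j ≡ v j) → β ≡ γ
  represents-injective u∼β v∼γ u≗v = injective _ _ (≈ᴹ-trans (expansion (expands-cong u≗v u∼β)) (≈ᴹ-sym (expansion v∼γ)))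

  unit-represents : ∀ i → unit i represents simple (a i)
  unit-represents i = by (≈ᴹ-sym (≈ᴹ-trans
    (linComb-singleton i _ (α ∘ a) (λ j i≢j → K.reflexive (≡.cong K.fromℤ (unit-≢ i≢j))))
    (≈ᴹ-trans (*ₗ-congʳ (K.trans (K.reflexive (≡.cong K.fromℤ (unit-≡ i))) K.fromℤ-1)) (*ₗ-identityˡ _))))

  represents-≼ : ∀ {β γ u v} → u represents β → v represents γ → (∀ j → u j ℤ.≤ v j) → β ≼ γ
  represents-≼ u∼β v∼γ u≤v b with any? (λ j → a j Fin.≟ b)
  ... | yes (j , ≡.refl) = ≡.subst₂ ℤ._≤_ (≡.sym (represents-coeff u∼β j)) (≡.sym (represents-coeff v∼γ j)) (u≤v j)
  ... | no ∄j = ℤ.≤-reflexive (≡.trans (lin-outside (expansion u∼β) b b∉a) (≡.sym (lin-outside (expansion v∼γ) b b∉a)))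
    where
    b∉a : ∀ j → a j ≢ b
    b∉a j aj≡b = ∄j (j , aj≡b)

  represents-positive : ∀ {γ v} → v represents γ → (∀ j → 0ℤ ℤ.≤ v j) → Positive γ
  represents-positive v∼γ 0≤v b with any? (λ j → a j Fin.≟ b)
  ... | yes (j , ≡.refl) = ≡.subst (0ℤ ℤ.≤_) (≡.sym (represents-coeff v∼γ j)) (0≤v j)
  ... | no ∄j = ℤ.≤-reflexive (≡.sym (lin-outside (expansion v∼γ) b (λ j aj≡b → ∄j (j , aj≡b))))

  represents-height : ∀ {γ v} → v represents γ → height γ ≡ sumℤ v
  represents-height {γ} {v} v∼γ = ≡.trans
    (SumOverImage.sum-image ℤ.+-0-commutativeMonoid a a-injective (coeff γ) (lin-outside (expansion v∼γ)))
    (Σℤ.sum-cong-≗ {x = coeff γ ∘ a} {v} (represents-coeff v∼γ))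

  represents-signCoherent : ∀ {γ v} → v represents γ → (∀ j → 0ℤ ℤ.≤ v j) ⊎ (∀ j → v j ℤ.≤ 0ℤ)
  represents-signCoherent {γ} v∼γ with signCoherent γ
  ... | inj₁ 0≤γ = inj₁ λ j → ≡.subst (0ℤ ℤ.≤_) (represents-coeff v∼γ j) (0≤γ (a j))
  ... | inj₂ γ≤0 = inj₂ λ j → ≡.subst (ℤ._≤ 0ℤ) (represents-coeff v∼γ j) (γ≤0 (a j))

  norm-root≉0 : ∀ γ → ¬ ⟪ root γ , root γ ⟫ K.≈ K.0#
  norm-root≉0 γ eq = nonzero γ (⟪⟫-nondegenerate _ eq)

  cartan-diagonal : ∀ γ → cartan γ γ ≡ + 2
  cartan-diagonal γ = K.fromℤ-injective (K.*-cancelʳ-≈ (norm-root≉0 γ) (K.trans (cartan-def γ γ) (K.sym twice)))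
    where
    N = ⟪ root γ , root γ ⟫
    twice : K.fromℤ (+ 2) K.* N K.≈ N K.+ N
    twice = K.trans (K.*-congʳ (K.+-congˡ K.fromℤ-1))
            (K.trans (K.distribʳ _ _ _) (K.+-cong (K.*-identityˡ N) (K.*-identityˡ N)))

  cartan-symmetrisable : ∀ β γ → K.fromℤ (cartan β γ) K.* ⟪ root γ , root γ ⟫
                               K.≈ K.fromℤ (cartan γ β) K.* ⟪ root β , root β ⟫
  cartan-symmetrisable β γ = K.trans (cartan-def β γ)
    (K.trans (K.+-cong (⟪⟫-comm _ _) (⟪⟫-comm _ _)) (K.sym (cartan-def γ β)))

  cartan≡0-sym : ∀ β γ → cartan β γ ≡ 0ℤ → cartan γ β ≡ 0ℤ
  cartan≡0-sym β γ ≡0 = K.fromℤ≈0⇒≡0 _ (K.*-cancelʳ-≈ (norm-root≉0 β) (K.trans (K.sym (cartan-symmetrisable β γ))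
    (K.trans (K.*-congʳ (K.reflexive (≡.cong K.fromℤ ≡0))) (K.trans (K.zeroˡ _) (K.sym (K.zeroˡ _))))))

  C-diagonal : ∀ i → C i i ≡ + 2
  C-diagonal i = ≡.trans (≡.sym (cartan≡C i i)) (cartan-diagonal _)

  twice-⟪lin,α⟫ : ∀ v i → let w = lin (K.fromℤ ∘ v) in
    ⟪ w , α (a i) ⟫ K.+ ⟪ w , α (a i) ⟫ K.≈ K.fromℤ (pairing C v i) K.* ⟪ α (a i) , α (a i) ⟫
  twice-⟪lin,α⟫ v i = begin
    ⟪ w , α (a i) ⟫ K.+ ⟪ w , α (a i) ⟫
      ≈⟨ twice-⟪⟫-linComb (K.fromℤ ∘ v) (α ∘ a) (α (a i)) ⟩
    K.sum (λ j → K.fromℤ (v j) K.* (⟪ α (a j) , α (a i) ⟫ K.+ ⟪ α (a j) , α (a i) ⟫))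
      ≈⟨ K.sum-cong-≋ step ⟩
    K.sum (λ j → K.fromℤ (v j ℤ.* C j i) K.* N)
      ≈⟨ K.*-distribʳ-sum N (λ j → K.fromℤ (v j ℤ.* C j i)) ⟨
    K.sum (λ j → K.fromℤ (v j ℤ.* C j i)) K.* N
      ≈⟨ K.*-congʳ (K.fromℤ-sum (λ j → v j ℤ.* C j i)) ⟨
    K.fromℤ (pairing C v i) K.* N ∎
    where
    open SetoidReasoning K.setoid
    w = lin (K.fromℤ ∘ v)
    N = ⟪ α (a i) , α (a i) ⟫
    step : ∀ j → K.fromℤ (v j) K.* (⟪ α (a j) , α (a i) ⟫ K.+ ⟪ α (a j) , α (a i) ⟫) K.≈ K.fromℤ (v j ℤ.* C j i) K.* N
    step j = begin
      K.fromℤ (v j) K.* (⟪ α (a j) , α (a i) ⟫ K.+ ⟪ α (a j) , α (a i) ⟫)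
        ≈⟨ K.*-congˡ (cartan-def (simple (a j)) (simple (a i))) ⟨
      K.fromℤ (v j) K.* (K.fromℤ (cartan (simple (a j)) (simple (a i))) K.* N)
        ≡⟨ ≡.cong (λ x → K.fromℤ (v j) K.* (K.fromℤ x K.* N)) (cartan≡C j i) ⟩
      K.fromℤ (v j) K.* (K.fromℤ (C j i) K.* N)
        ≈⟨ K.*-assoc _ _ _ ⟨
      K.fromℤ (v j) K.* K.fromℤ (C j i) K.* N
        ≈⟨ K.*-congʳ (K.fromℤ-* (v j) (C j i)) ⟨
      K.fromℤ (v j ℤ.* C j i) K.* N ∎

  cartan-pairing : ∀ {γ v} → v represents γ → ∀ i → cartan γ (simple (a i)) ≡ pairing C v i
  cartan-pairing {γ} {v} v∼γ i = K.fromℤ-injective (K.*-cancelʳ-≈ (norm-root≉0 (simple (a i)))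
    (K.trans (cartan-def γ (simple (a i))) (K.trans (K.+-cong γ≈ γ≈) (twice-⟪lin,α⟫ v i))))
    where
    γ≈ = ⟪⟫-cong (expansion v∼γ) ≈ᴹ-refl

  reflect-represents : ∀ {γ v} → v represents γ → ∀ i → ∃[ γ′ ] reflect C i v represents γ′
  reflect-represents {γ} {v} v∼γ i with reflection γ (simple (a i))
  ... | γ′ , γ′≈ = γ′ , by (begin
    root γ′
      ≈⟨ γ′≈ ⟩
    root γ +ᴹ -ᴹ (K.fromℤ (cartan γ (simple (a i))) *ₗ α (a i))
      ≡⟨ ≡.cong (λ x → root γ +ᴹ -ᴹ (K.fromℤ x *ₗ α (a i))) (cartan-pairing v∼γ i) ⟩
    root γ +ᴹ -ᴹ (k *ₗ α (a i))
      ≈⟨ +ᴹ-cong (expansion v∼γ) (-ᴹ‿cong (*ₗ-congˡ (expansion (unit-represents i)))) ⟩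
    lin (K.fromℤ ∘ v) +ᴹ -ᴹ (k *ₗ lin (K.fromℤ ∘ unit i))
      ≈⟨ +ᴹ-congˡ (-ᴹ‿cong (linComb-* k _ (α ∘ a))) ⟨
    lin (K.fromℤ ∘ v) +ᴹ -ᴹ lin (λ j → k K.* K.fromℤ (unit i j))
      ≈⟨ +ᴹ-congˡ (linComb-neg _ (α ∘ a)) ⟨
    lin (K.fromℤ ∘ v) +ᴹ lin (λ j → K.- (k K.* K.fromℤ (unit i j)))
      ≈⟨ linComb-+ _ _ (α ∘ a) ⟨
    lin (λ j → K.fromℤ (v j) K.+ K.- (k K.* K.fromℤ (unit i j)))
      ≈⟨ linComb-cong (α ∘ a) (λ j → K.sym (K.trans (K.fromℤ-- (v j) (pairing C v i ℤ.* unit i j))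
           (K.+-congˡ (K.-‿cong (K.fromℤ-* (pairing C v i) (unit i j)))))) ⟩
    lin (K.fromℤ ∘ reflect C i v) ∎)
    where
    open SetoidReasoning ≈ᴹ-setoid
    k = K.fromℤ (pairing C v i)

  -- That a given vector belongs to a root is not among the data of a base; reaching it from a
  -- simple root by reflections proves it. The last letter of the word acts first.
  word-represents : ∀ (w : List (Fin p)) i →
    ∃[ γ ] lookup (reflectSimple C w i) represents γ
  word-represents []      i = simple (a i) , expands-cong (λ j → ≡.sym (lookup∘tabulate (unit i) j)) (unit-represents i)
  word-represents (k ∷ w) i with word-represents w i
  ... | γ , v∼γ with reflect-represents v∼γ k
  ... | γ′ , v′∼γ′ = γ′ , expands-cong (λ j → ≡.sym (lookup∘tabulate (reflect C k (lookup (reflectSimple C w i))) j)) v′∼γ′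

  -- The reflection of αⱼ in αᵢ has coefficient 1 at j and -⟨αⱼ,αᵢ^∨⟩ at i; sign coherence makes the
  -- latter nonnegative.
  C-nonPositive : ∀ {j i} → i ≢ j → C j i ℤ.≤ 0ℤ
  C-nonPositive {j} {i} i≢j with represents-signCoherent (proj₂ (reflect-represents (unit-represents j) i))
  ... | inj₁ 0≤v = ℤ.neg-cancel-≤ (≡.subst (0ℤ ℤ.≤_) (≡.trans
      (≡.cong₂ (λ x y → x ℤ.- k ℤ.* y) (unit-≢ (i≢j ∘ ≡.sym)) (unit-≡ i))
      (≡.trans (ℤ.+-identityˡ (ℤ.- (k ℤ.* 1ℤ))) (≡.cong ℤ.-_ (≡.trans (ℤ.*-identityʳ k) k≡C)))) (0≤v i))
    where
    k = pairing C (unit j) i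
    k≡C : k ≡ C j i
    k≡C = ≡.trans (sumℤ-singleton j _ (λ l j≢l → ≡.cong (ℤ._* C l i) (unit-≢ j≢l)))
      (≡.trans (≡.cong (ℤ._* C j i) (unit-≡ j)) (ℤ.*-identityˡ (C j i)))
  ... | inj₂ v≤0 = contradiction (≡.subst (ℤ._≤ 0ℤ) vj≡1 (v≤0 j)) λ { (ℤ.+≤+ ()) }
    where
    vj≡1 : reflect C i (unit j) j ≡ 1ℤ
    vj≡1 = ≡.trans (≡.cong₂ (λ x y → x ℤ.- pairing C (unit j) i ℤ.* y) (unit-≡ j) (unit-≢ i≢j))
      (≡.cong (λ x → 1ℤ ℤ.- x) (ℤ.*-zeroʳ (pairing C (unit j) i)))

  -- The Gram form is positive definite, and 2⟪w,w⟫ = Σᵢ vᵢ ⟨w,αᵢ^∨⟩ ⟪αᵢ,αᵢ⟫ for w = Σⱼ vⱼ αⱼ.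
  nonPositive⇒lin≈0 : ∀ v → (∀ i → v i ℤ.* pairing C v i ℤ.≤ 0ℤ) → lin (K.fromℤ ∘ v) ≈ᴹ 0ᴹ
  nonPositive⇒lin≈0 v v*≤0 = ⟪⟫-nondegenerate w (K.0≤x∧x+x≤0⇒x≈0 (⟪⟫-nonNegative w)
    (K.≤-respˡ-≈ (K.sym (begin
      ⟪ w , w ⟫ K.+ ⟪ w , w ⟫
        ≈⟨ twice-⟪⟫-linComb (K.fromℤ ∘ v) (α ∘ a) w ⟩
      K.sum (λ i → K.fromℤ (v i) K.* (⟪ α (a i) , w ⟫ K.+ ⟪ α (a i) , w ⟫))
        ≈⟨ K.sum-cong-≋ step ⟩
      K.sum (λ i → K.fromℤ (v i ℤ.* pairing C v i) K.* N i) ∎))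
    (K.sum-nonPositive _ (λ i → K.fromℤ-*-nonPositive (v*≤0 i) (⟪⟫-nonNegative _)))))
    where
    open SetoidReasoning K.setoid
    w = lin (K.fromℤ ∘ v)
    N : Fin p → K.Carrier
    N i = ⟪ α (a i) , α (a i) ⟫
    step : ∀ i → K.fromℤ (v i) K.* (⟪ α (a i) , w ⟫ K.+ ⟪ α (a i) , w ⟫) K.≈ K.fromℤ (v i ℤ.* pairing C v i) K.* N i
    step i = begin
      K.fromℤ (v i) K.* (⟪ α (a i) , w ⟫ K.+ ⟪ α (a i) , w ⟫)
        ≈⟨ K.*-congˡ (K.+-cong (⟪⟫-comm _ _) (⟪⟫-comm _ _)) ⟩
      K.fromℤ (v i) K.* (⟪ w , α (a i) ⟫ K.+ ⟪ w , α (a i) ⟫)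
        ≈⟨ K.*-congˡ (twice-⟪lin,α⟫ v i) ⟩
      K.fromℤ (v i) K.* (K.fromℤ (pairing C v i) K.* N i)
        ≈⟨ K.*-assoc _ _ _ ⟨
      K.fromℤ (v i) K.* K.fromℤ (pairing C v i) K.* N i
        ≈⟨ K.*-congʳ (K.fromℤ-* (v i) (pairing C v i)) ⟨
      K.fromℤ (v i ℤ.* pairing C v i) K.* N i ∎

  nonPositive⇒≡0 : ∀ v → (∀ i → v i ℤ.* pairing C v i ℤ.≤ 0ℤ) → ∀ j → v j ≡ 0ℤ
  nonPositive⇒≡0 v v*≤0 j = K.fromℤ≈0⇒≡0 (v j) (K.trans
    (K.reflexive (≡.sym (extend-image a K.0# (K.fromℤ ∘ v) a-injective j)))
    (independent _ (≈ᴹ-trans (linComb-extend a a-injective _ α) (nonPositive⇒lin≈0 v v*≤0)) (a j)))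

  -- Weighted by the positive norms of the αᵢ, these products add up to 2⟪γ,γ⟫, so if none were
  -- positive then γ would be 0.
  represents-pairing>0 : ∀ {γ v} → v represents γ → ∃[ i ] 0ℤ ℤ.< v i ℤ.* pairing C v i
  represents-pairing>0 {γ} {v} v∼γ with any? (λ i → 0ℤ ℤ.<? v i ℤ.* pairing C v i)
  ... | yes ∃i = ∃i
  ... | no ∄i  = contradiction (≈ᴹ-trans (expansion v∼γ) (nonPositive⇒lin≈0 v (λ i → ℤ.≮⇒≥ (λ 0<i → ∄i (i , 0<i))))) (nonzero γ)

  -- Reducedness leaves only the multiples αᵢ and -αᵢ, and the sign of `v i` excludes the second.
  represents-multiple : ∀ {γ v} i → v represents γ → 0ℤ ℤ.≤ v i → (∀ j → i ≢ j → v j ≡ 0ℤ) → ∀ j → unit i j ≡ v j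
  represents-multiple {γ} {v} i v∼γ 0≤vi v≡0 j with i Fin.≟ j
  ... | no i≢j = ≡.sym (v≡0 j i≢j)
  ... | yes ≡.refl with reduced γ (simple (a i)) (K.fromℤ (v i))
                          (≈ᴹ-trans (expansion v∼γ) (linComb-singleton i _ (α ∘ a) (λ j i≢j → K.reflexive (≡.cong K.fromℤ (v≡0 j i≢j)))))
  ...   | inj₁ ≈1  = K.fromℤ-injective (K.trans K.fromℤ-1 (K.sym ≈1))
  ...   | inj₂ ≈-1 = contradiction (≡.subst (0ℤ ℤ.≤_) (K.fromℤ-injective {v i} {ℤ.- 1ℤ} (K.trans ≈-1 (K.-‿cong (K.sym K.fromℤ-1)))) 0≤vi) λ ()

  module _ {L : List (Vec ℤ p)} (closed : ClosedUnderReflections C L) where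
    private
      -- Some αᵢ with vᵢ > 0 pairs positively with v; reflecting in it lowers the height,
      -- unless v is a multiple of αᵢ.
      descend : ∀ n {γ v} → v represents γ → (∀ j → 0ℤ ℤ.≤ v j) → sumℤ v ℤ.≤ + n → tabulate v List.∈ L
      descend n {γ} {v} v∼γ 0≤v Σv≤n with represents-pairing>0 v∼γ
      ... | i , 0<vi*k = [ lower n Σv≤n , multiple ]′ (represents-signCoherent v′∼γ′)
        where
        k = pairing C v i
        v′ = reflect C i v
        v′∼γ′ = proj₂ (reflect-represents v∼γ i)

        0<k : 0ℤ ℤ.< k
        0<k = ℤ.≰⇒> λ k≤0 → ℤ.<⇒≱ 0<vi*k
          (≡.subst (v i ℤ.* k ℤ.≤_) (ℤ.*-zeroʳ (v i)) (ℤ.*-monoˡ-≤-nonNeg (v i) {{ℤ.nonNegative (0≤v i)}} k≤0))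

        Σv′<Σv : sumℤ v′ ℤ.< sumℤ v
        Σv′<Σv = ≡.subst₂ ℤ._<_ (≡.sym (sumℤ-reflect C i v)) (ℤ.+-identityʳ (sumℤ v)) (ℤ.+-monoʳ-< (sumℤ v) (ℤ.neg-mono-< 0<k))

        -- The reflection alters coordinate `i` only, so every other coordinate of `v` is both
        -- nonnegative and nonpositive, and `v` is a multiple of αᵢ.
        multiple : (∀ j → v′ j ℤ.≤ 0ℤ) → tabulate v List.∈ L
        multiple v′≤0 = ≡.subst (List._∈ L) (tabulate-cong (represents-multiple i v∼γ (0≤v i) v≡0)) (proj₁ closed i)
          where
          v′≡v : ∀ j → i ≢ j → v′ j ≡ v j
          v′≡v j i≢j = ≡.trans (≡.cong (λ u → v j ℤ.- k ℤ.* u) (unit-≢ i≢j))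
                         (≡.trans (≡.cong (λ u → v j ℤ.- u) (ℤ.*-zeroʳ k)) (ℤ.+-identityʳ (v j)))
          v≡0 : ∀ j → i ≢ j → v j ≡ 0ℤ
          v≡0 j i≢j = ℤ.≤-antisym (≡.subst (ℤ._≤ 0ℤ) (v′≡v j i≢j) (v′≤0 j)) (0≤v j)

        lower : ∀ n → sumℤ v ℤ.≤ + n → (∀ j → 0ℤ ℤ.≤ v′ j) → tabulate v List.∈ L
        -- With the bound exhausted, `v′` would have a negative coordinate sum in spite of being
        -- nonnegative.
        lower ℕ.zero    Σv≤0 0≤v′ = contradiction (sumℤ-nonNegative 0≤v′) (ℤ.<⇒≱ (ℤ.<-≤-trans Σv′<Σv Σv≤0))
        -- The reflected vector is in the list by induction, and the same reflection carries it back
        -- to `v`, which is nonnegative and hence also in the list.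
        lower (ℕ.suc n) Σv≤n 0≤v′ = ≡.subst (List._∈ L) (tabulate-cong back)
          (All.lookup (proj₂ closed i) (descend n v′∼γ′ 0≤v′ (ℤ.i<j⇒i≤pred[j] (ℤ.<-≤-trans Σv′<Σv Σv≤n)))
            (λ j → ≡.subst (0ℤ ℤ.≤_) (≡.sym (back j)) (0≤v j)))
          where
          back : ∀ j → reflect C i (lookup (tabulate v′)) j ≡ v j
          back j = ≡.trans (reflect-cong C i (lookup∘tabulate v′) j) (reflect-involutive C i v (C-diagonal i) j)

    positive-root∈ : ∀ {γ v} → v represents γ → (∀ j → 0ℤ ℤ.≤ v j) → tabulate v List.∈ L
    positive-root∈ {v = v} v∼γ 0≤v = descend ℤ.∣ sumℤ v ∣ v∼γ 0≤v (ℤ.≤-reflexive (≡.sym (ℤ.0≤i⇒+∣i∣≡i (sumℤ-nonNegative 0≤v))))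

-- Planes, spans and the criterion for failure of line-closedness

subset : ∀ {n ℓ} {P : Fin n → Set ℓ} → (∀ i → Dec (P i)) → Subset n
subset P? = tabulate (λ i → does (P? i))

module _ {n ℓ} {P : Fin n → Set ℓ} (P? : ∀ i → Dec (P i)) where

  ∈subset⁺ : ∀ {i} → P i → i ∈ subset P?
  ∈subset⁺ {i} Pi = lookup⇒[]= i (subset P?) (≡.trans (lookup∘tabulate (λ i → does (P? i)) i) (dec-true (P? i) Pi))

  ∈subset⁻ : ∀ {i} → i ∈ subset P? → P i
  ∈subset⁻ {i} i∈ with P? i | ≡.trans (≡.sym (lookup∘tabulate (λ i → does (P? i)) i)) ([]=⇒lookup i∈)
  ... | yes Pi | _ = Pi

module ArrangementProperties {c ℓ₁ ℓ₂ m ℓm} {K : OrderedField c ℓ₁ ℓ₂} (E : EuclideanSpace K m ℓm)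
                             {n} (v : Fin n → EuclideanSpace.Carrierᴹ E) where
  private module K = OrderedField K
  open EuclideanSpace E
  open EuclideanSpaceProperties E
  open Arrangement E v

  span-pair : ∀ {x} a b → x ∈span (⁅ a ⁆ ∪ ⁅ b ⁆) → ∃[ k ] ∃[ l ] x ≈ᴹ k *ₗ v a +ᴹ l *ₗ v b
  span-pair {x} a b (k , k≈0 , x≈) with a Fin.≟ b
  -- `linComb-image` needs distinct indices, so a degenerate pair is treated apart, with second
  -- coefficient 0.
  ... | yes ≡.refl = k a , K.0# , ≈ᴹ-trans x≈ (≈ᴹ-trans
      (linComb-singleton a k v (λ j a≢j → k≈0 j (λ j∈ →
        [ a≢j ∘ ≡.sym ∘ x∈⁅y⁆⇒x≡y a , a≢j ∘ ≡.sym ∘ x∈⁅y⁆⇒x≡y a ]′ (x∈p∪q⁻ ⁅ a ⁆ ⁅ a ⁆ j∈))))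
      (≈ᴹ-trans (≈ᴹ-sym (+ᴹ-identityʳ _)) (+ᴹ-congˡ (≈ᴹ-sym (*ₗ-zeroˡ (v a))))))
  ... | no a≢b = k a , k b , ≈ᴹ-trans x≈ (≈ᴹ-trans
      (linComb-image ab ab-injective k v
        (λ j ab≢j → k≈0 j (λ j∈ →
          [ ab≢j zero ∘ ≡.sym ∘ x∈⁅y⁆⇒x≡y a , ab≢j (suc zero) ∘ ≡.sym ∘ x∈⁅y⁆⇒x≡y b ]′ (x∈p∪q⁻ ⁅ a ⁆ ⁅ b ⁆ j∈))))
      (+ᴹ-congˡ (+ᴹ-identityʳ _)))
    where
    ab : Fin 2 → Fin n
    ab zero       = a
    ab (suc zero) = b
    ab-injective : ∀ i j → ab i ≡ ab j → i ≡ j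
    ab-injective zero       zero       _   = ≡.refl
    ab-injective zero       (suc zero) a≡b = contradiction a≡b a≢b
    ab-injective (suc zero) zero       b≡a = contradiction (≡.sym b≡a) a≢b
    ab-injective (suc zero) (suc zero) _   = ≡.refl

dot : ∀ {p} → (Fin p → ℤ) → (Fin p → ℤ) → ℤ
dot f v = sumℤ (λ j → f j ℤ.* v j)

-- The functionals in F certify that every vector of L in the plane of T s and T t
-- belongs to T.
PlaneClosed : ∀ {p q} → List (Vec ℤ p) → List (Vec ℤ p) → (Fin q → Vec ℤ p) → Set
PlaneClosed F L T = ∀ s t → All (λ u →
  All (λ f → dot (lookup f) (lookup (T s)) ≡ 0ℤ → dot (lookup f) (lookup (T t)) ≡ 0ℤ → dot (lookup f) (lookup u) ≡ 0ℤ) F →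
  ∃[ r ] T r ≡ u) L

planeClosed? : ∀ {p q} F L (T : Fin q → Vec ℤ p) → Dec (PlaneClosed F L T)
planeClosed? F L T = all? λ s → all? λ t → All.all? (λ u →
  All.all? (λ f → (dot (lookup f) (lookup (T s)) ℤ.≟ 0ℤ) →-dec ((dot (lookup f) (lookup (T t)) ℤ.≟ 0ℤ) →-dec (dot (lookup f) (lookup u) ℤ.≟ 0ℤ))) F
  →-dec any? (λ r → ≡-dec ℤ._≟_ (T r) u)) L

module LineClosure
    {c ℓ₁ ℓ₂ m ℓm} {K : OrderedField c ℓ₁ ℓ₂} {E : EuclideanSpace K m ℓm}
    {Φ : RootSystem E} (Δ : Base Φ)
    {p} (a : Fin p → Fin (Base.rank Δ)) (a-injective : ∀ i j → a i ≡ a j → i ≡ j)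
    (C : Fin p → Fin p → ℤ)
    (cartan≡C : ∀ j i → RootSystem.cartan Φ (Base.simple Δ (a j)) (Base.simple Δ (a i)) ≡ C j i) where
  private module K where
    open OrderedField K hiding (zero) public
    open OrderedFieldProperties K public
    open SemiringSum semiring public
  open EuclideanSpace E
  open EuclideanSpaceProperties E
  open RootSystem Φ
  open Base Δ
  open SubBase Δ a a-injective C cartan≡C
  open ArrangementProperties E root

  -- The combination has coefficients in `K`, yet `dot f u` is an integer; its image in `K` vanishes
  -- by linearity, and ℤ embeds in `K`.
  dot-lin : ∀ f u x y s t → (∀ j → K.fromℤ (u j) K.≈ x K.* K.fromℤ (s j) K.+ y K.* K.fromℤ (t j)) →
            dot f s ≡ 0ℤ → dot f t ≡ 0ℤ → dot f u ≡ 0ℤ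
  dot-lin f u x y s t u≈ fs≡0 ft≡0 = K.fromℤ≈0⇒≡0 _ (begin
    K.fromℤ (dot f u)                                        ≈⟨ K.fromℤ-sum (λ j → f j ℤ.* u j) ⟩
    K.sum (λ j → K.fromℤ (f j ℤ.* u j))                      ≈⟨ K.sum-cong-≋ step ⟩
    K.sum (λ j → x K.* fs j K.+ y K.* ft j)                  ≈⟨ K.∑-distrib-+ (λ j → x K.* fs j) (λ j → y K.* ft j) ⟩
    K.sum (λ j → x K.* fs j) K.+ K.sum (λ j → y K.* ft j)    ≈⟨ K.+-cong (K.*-distribˡ-sum x fs) (K.*-distribˡ-sum y ft) ⟨
    x K.* K.sum fs K.+ y K.* K.sum ft                        ≈⟨ K.+-cong (K.*-congˡ (vanishes s fs≡0)) (K.*-congˡ (vanishes t ft≡0)) ⟩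
    x K.* K.0# K.+ y K.* K.0#                                ≈⟨ K.+-cong (K.zeroʳ x) (K.zeroʳ y) ⟩
    K.0# K.+ K.0#                                            ≈⟨ K.+-identityˡ K.0# ⟩
    K.0#                                                     ∎)
    where
    open SetoidReasoning K.setoid
    fs ft : Fin p → K.Carrier
    fs j = K.fromℤ (f j ℤ.* s j)
    ft j = K.fromℤ (f j ℤ.* t j)

    vanishes : ∀ v → dot f v ≡ 0ℤ → K.sum (λ j → K.fromℤ (f j ℤ.* v j)) K.≈ K.0#
    vanishes v fv≡0 = K.trans (K.sym (K.fromℤ-sum (λ j → f j ℤ.* v j))) (K.reflexive (≡.cong K.fromℤ fv≡0))

    swap : ∀ j z v → K.fromℤ (f j) K.* (z K.* K.fromℤ v) K.≈ z K.* K.fromℤ (f j ℤ.* v)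
    swap j z v = begin
      K.fromℤ (f j) K.* (z K.* K.fromℤ v)   ≈⟨ K.*-assoc _ _ _ ⟨
      K.fromℤ (f j) K.* z K.* K.fromℤ v     ≈⟨ K.*-congʳ (K.*-comm _ _) ⟩
      z K.* K.fromℤ (f j) K.* K.fromℤ v     ≈⟨ K.*-assoc _ _ _ ⟩
      z K.* (K.fromℤ (f j) K.* K.fromℤ v)   ≈⟨ K.*-congˡ (K.fromℤ-* (f j) v) ⟨
      z K.* K.fromℤ (f j ℤ.* v)             ∎

    step : ∀ j → K.fromℤ (f j ℤ.* u j) K.≈ x K.* fs j K.+ y K.* ft j
    step j = begin
      K.fromℤ (f j ℤ.* u j)                                              ≈⟨ K.fromℤ-* (f j) (u j) ⟩
      K.fromℤ (f j) K.* K.fromℤ (u j)                                    ≈⟨ K.*-congˡ (u≈ j) ⟩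
      K.fromℤ (f j) K.* (x K.* K.fromℤ (s j) K.+ y K.* K.fromℤ (t j))    ≈⟨ K.distribˡ _ _ _ ⟩
      K.fromℤ (f j) K.* (x K.* K.fromℤ (s j)) K.+ K.fromℤ (f j) K.* (y K.* K.fromℤ (t j))
                                                                         ≈⟨ K.+-cong (swap j x (s j)) (swap j y (t j)) ⟩
      x K.* fs j K.+ y K.* ft j                                          ∎

  -- The set I ∩ T is 2-closed, and its span contains the simple root indexed by i₀, which is not in T.
  module _
    {L : List (Vec ℤ p)} (closed : ClosedUnderReflections C L)
    {q} (T : Fin q → Vec ℤ p) (T-injective : ∀ s t → T s ≡ T t → s ≡ t)
    {F : List (Vec ℤ p)} (planeClosed : PlaneClosed F L T)
    (i₀ : Fin p) (i₀∉T : ∀ t → T t ≢ tabulate (unit i₀))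
    (d : ℕ) (k : Fin q → ℤ) (k*T≡d*i₀ : ∀ j → sumℤ (λ t → k t ℤ.* lookup (T t) j) ≡ + ℕ.suc d ℤ.* unit i₀ j)
    {index : Fin q → Fin size} (T-roots : ∀ t → lookup (T t) represents index t)
    {I : Subset size} (I-positive : ∀ γ → γ ∈ I → Positive γ)
    (simple∈I : simple (a i₀) ∈ I) (index∈I : ∀ t → k t ≢ 0ℤ → index t ∈ I)
    where

    private
      -- The set is cut out by comparing indices, which is decidable, not by membership in the span
      -- of the subsystem.
      ∈S? : ∀ γ → Dec (γ ∈ I × ∃[ t ] index t ≡ γ)
      ∈S? γ = (γ ∈? I) ×-dec any? (λ t → index t Fin.≟ γ)

      S : Subset size
      S = subset ∈S?

      vector-≡ : ∀ {u v : Vec ℤ p} → (∀ j → lookup u j ≡ lookup v j) → u ≡ v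
      vector-≡ {u} {v} u≗v = ≡.trans (≡.sym (tabulate∘lookup u)) (≡.trans (tabulate-cong u≗v) (tabulate∘lookup v))

      index-injective : ∀ s t → index s ≡ index t → s ≡ t
      index-injective s t eq = T-injective s t (vector-≡ λ j → ≡.trans (≡.sym (represents-coeff (T-roots s) j))
        (≡.trans (≡.cong (λ γ → coeff γ (a j)) eq) (represents-coeff (T-roots t) j)))

      -- A root of `I` in the plane of two roots of `T` has integer coordinates by `lin-represents`,
      -- so it appears in the complete list `L`. The functionals that kill both roots kill it too,
      -- which puts its vector in `T`; roots with equal vectors are equal.
      2-closed : Is2Closed I S
      2-closed β γ β∈S γ∈S i (i∈I , i∈span) with ∈subset⁻ ∈S? β∈S | ∈subset⁻ ∈S? γ∈S
      ... | _ , s , ≡.refl | _ , t , ≡.refl with span-pair (index s) (index t) i∈span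
      ... | x , y , i≈ = ∈subset⁺ ∈S? (i∈I , r , represents-injective (T-roots r) u∼i Tr≗u)
        where
        i≈lin : root i ≈ᴹ lin (λ j → x K.* K.fromℤ (lookup (T s) j) K.+ y K.* K.fromℤ (lookup (T t) j))
        i≈lin = ≈ᴹ-trans i≈ (≈ᴹ-sym (≈ᴹ-trans (linComb-+ _ _ (α ∘ a)) (+ᴹ-cong
          (≈ᴹ-trans (linComb-* x _ (α ∘ a)) (*ₗ-congˡ (≈ᴹ-sym (expansion (T-roots s)))))
          (≈ᴹ-trans (linComb-* y _ (α ∘ a)) (*ₗ-congˡ (≈ᴹ-sym (expansion (T-roots t))))))))

        u : Fin p → ℤ
        u = coeff i ∘ a

        u∼i : u represents i
        u∼i = lin-represents i≈lin

        u∈L : tabulate u List.∈ L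
        u∈L = positive-root∈ closed u∼i (λ j → I-positive i i∈I (a j))

        u∈T : ∃[ r ] T r ≡ tabulate u
        u∈T = All.lookup (planeClosed s t) u∈L (All.universal (λ f →
          dot-lin (lookup f) (lookup (tabulate u)) x y (lookup (T s)) (lookup (T t))
            (λ j → K.trans (K.reflexive (≡.cong K.fromℤ (lookup∘tabulate u j))) (lin-coeff i≈lin j))) F)

        r = proj₁ u∈T

        Tr≗u : ∀ j → lookup (T r) j ≡ u j
        Tr≗u j = ≡.trans (≡.cong (λ v → lookup v j) (proj₂ u∈T)) (lookup∘tabulate u j)

      simple∉S : simple (a i₀) ∉ S
      simple∉S ∈S with ∈subset⁻ ∈S? ∈S
      ... | _ , t , eq = i₀∉T t (≡.trans (≡.sym (tabulate∘lookup (T t))) (tabulate-cong λ j →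
        ≡.trans (≡.sym (represents-coeff (T-roots t) j))
          (≡.trans (≡.cong (λ γ → coeff γ (a j)) eq) (represents-coeff (unit-represents i₀) j))))

      simple∈span : α (a i₀) ∈span S
      simple∈span = extend index K.0# l , l≈0 , (begin
        α (a i₀)
          ≈⟨ expansion (unit-represents i₀) ⟩
        lin (K.fromℤ ∘ unit i₀)
          ≈⟨ linComb-cong (α ∘ a) unit≈ ⟩
        lin (λ j → K.sum (λ t → l t K.* K.fromℤ (lookup (T t) j)))
          ≈⟨ linComb-linComb l (λ t → K.fromℤ ∘ lookup (T t)) (α ∘ a) ⟨
        linComb l (λ t → lin (K.fromℤ ∘ lookup (T t)))
          ≈⟨ linComb-congʳ l (λ t → expansion (T-roots t)) ⟨
        linComb l (root ∘ index)
          ≈⟨ linComb-extend index index-injective l root ⟨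
        linComb (extend index K.0# l) root ∎)
        where
        open SetoidReasoning ≈ᴹ-setoid
        -- The integral relation produces `suc d` times the simple root; the division takes place in
        -- `K`, where `suc d` is invertible by characteristic zero.
        d⁻¹ = proj₁ (K.inverse (K.fromℤ (+ ℕ.suc d)) (K.[1+n]⋆1≉0 d))
        d*d⁻¹≈1 = proj₂ (K.inverse (K.fromℤ (+ ℕ.suc d)) (K.[1+n]⋆1≉0 d))

        l : Fin q → K.Carrier
        l t = d⁻¹ K.* K.fromℤ (k t)

        unit≈ : ∀ j → K.fromℤ (unit i₀ j) K.≈ K.sum (λ t → l t K.* K.fromℤ (lookup (T t) j))
        unit≈ j = K.sym (R.begin
          K.sum (λ t → l t K.* K.fromℤ (lookup (T t) j))
            R.≈⟨ K.sum-cong-≋ (λ t → K.trans (K.*-assoc d⁻¹ (K.fromℤ (k t)) (K.fromℤ (lookup (T t) j)))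
                   (K.*-congˡ (K.sym (K.fromℤ-* (k t) (lookup (T t) j))))) ⟩
          K.sum (λ t → d⁻¹ K.* K.fromℤ (k t ℤ.* lookup (T t) j))
            R.≈⟨ K.*-distribˡ-sum d⁻¹ (λ t → K.fromℤ (k t ℤ.* lookup (T t) j)) ⟨
          d⁻¹ K.* K.sum (λ t → K.fromℤ (k t ℤ.* lookup (T t) j))
            R.≈⟨ K.*-congˡ (K.fromℤ-sum (λ t → k t ℤ.* lookup (T t) j)) ⟨
          d⁻¹ K.* K.fromℤ (sumℤ (λ t → k t ℤ.* lookup (T t) j))
            R.≡⟨ ≡.cong (λ x → d⁻¹ K.* K.fromℤ x) (k*T≡d*i₀ j) ⟩
          d⁻¹ K.* K.fromℤ (+ ℕ.suc d ℤ.* unit i₀ j)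
            R.≈⟨ K.*-congˡ (K.fromℤ-* (+ ℕ.suc d) (unit i₀ j)) ⟩
          d⁻¹ K.* (K.fromℤ (+ ℕ.suc d) K.* K.fromℤ (unit i₀ j))
            R.≈⟨ K.*-assoc _ _ _ ⟨
          d⁻¹ K.* K.fromℤ (+ ℕ.suc d) K.* K.fromℤ (unit i₀ j)
            R.≈⟨ K.*-congʳ (K.trans (K.*-comm _ _) d*d⁻¹≈1) ⟩
          K.1# K.* K.fromℤ (unit i₀ j)
            R.≈⟨ K.*-identityˡ _ ⟩
          K.fromℤ (unit i₀ j) R.∎)
          where module R = SetoidReasoning K.setoid

        -- A root of `T` outside `S` is missing from `I`, and `index∈I` allows this only if its
        -- coefficient is zero.
        l≈0 : ∀ γ → γ ∉ S → extend index K.0# l γ K.≈ K.0#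
        l≈0 γ γ∉S with any? (λ t → index t Fin.≟ γ)
        ... | no  _            = K.refl
        ... | yes (t , ≡.refl) = K.trans (K.*-congˡ (K.reflexive (≡.cong K.fromℤ kt≡0))) (K.zeroʳ d⁻¹)
          where
          kt≡0 : k t ≡ 0ℤ
          kt≡0 = decidable-stable (k t ℤ.≟ 0ℤ) (λ kt≢0 → γ∉S (∈subset⁺ ∈S? (index∈I t kt≢0 , t , ≡.refl)))

    not-lineClosed : ¬ LineClosed I
    not-lineClosed lineClosed = simple∉S (Equivalence.to
      (lineClosed S (proj₁ ∘ ∈subset⁻ ∈S?) 2-closed (simple (a i₀)))
      (simple∈I , simple∈span))

-- Cartan integers of two simple roots

bond : Fin 2 → ℤ
bond b = ℤ.- + toℕ b

-- The two implications exclude x = 0 with y negative and the reverse, which the bound on the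
-- product alone would admit.
nonPositive-product≤1 : ∀ x y → x ℤ.≤ 0ℤ → y ℤ.≤ 0ℤ → (x ≡ 0ℤ → y ≡ 0ℤ) → (y ≡ 0ℤ → x ≡ 0ℤ) →
                        x ℤ.* y ℤ.≤ 1ℤ → ∃[ b ] x ≡ bond b × y ≡ bond b
nonPositive-product≤1 (+ 0) y x≤0 y≤0 x⇒y y⇒x xy≤1 = 0F , ≡.refl , x⇒y ≡.refl
nonPositive-product≤1 (+ ℕ.suc _) y (ℤ.+≤+ ()) y≤0 x⇒y y⇒x xy≤1
nonPositive-product≤1 -[1+ m ] (+ 0) x≤0 y≤0 x⇒y y⇒x xy≤1 = contradiction (y⇒x ≡.refl) λ ()
nonPositive-product≤1 -[1+ m ] (+ ℕ.suc _) x≤0 (ℤ.+≤+ ()) x⇒y y⇒x xy≤1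
nonPositive-product≤1 -[1+ 0 ] -[1+ 0 ] x≤0 y≤0 x⇒y y⇒x xy≤1 = 1F , ≡.refl , ≡.refl
nonPositive-product≤1 -[1+ 0 ] -[1+ ℕ.suc n ] x≤0 y≤0 x⇒y y⇒x (ℤ.+≤+ (s≤s ()))
nonPositive-product≤1 -[1+ ℕ.suc m ] -[1+ 0 ] x≤0 y≤0 x⇒y y⇒x (ℤ.+≤+ (s≤s ()))
nonPositive-product≤1 -[1+ ℕ.suc m ] -[1+ ℕ.suc n ] x≤0 y≤0 x⇒y y⇒x (ℤ.+≤+ (s≤s ()))

nonPositive-product≡2 : ∀ x y → x ℤ.≤ 0ℤ → y ℤ.≤ 0ℤ → x ℤ.* y ≡ + 2 →
                        (x ≡ -1ℤ × y ≡ -[1+ 1 ]) ⊎ (x ≡ -[1+ 1 ] × y ≡ -1ℤ)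
nonPositive-product≡2 (+ 0) y x≤0 y≤0 ()
nonPositive-product≡2 (+ ℕ.suc _) y (ℤ.+≤+ ()) y≤0 xy≡2
nonPositive-product≡2 x@(-[1+ _ ]) (+ 0) x≤0 y≤0 xy≡2 = contradiction (≡.trans (≡.sym (ℤ.*-zeroʳ x)) xy≡2) λ ()
nonPositive-product≡2 -[1+ m ] (+ ℕ.suc _) x≤0 (ℤ.+≤+ ()) xy≡2
nonPositive-product≡2 -[1+ 0 ] -[1+ 1 ] x≤0 y≤0 xy≡2 = inj₁ (≡.refl , ≡.refl)
nonPositive-product≡2 -[1+ 1 ] -[1+ 0 ] x≤0 y≤0 xy≡2 = inj₂ (≡.refl , ≡.refl)
nonPositive-product≡2 -[1+ 0 ] -[1+ ℕ.suc (ℕ.suc n) ] x≤0 y≤0 ()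
nonPositive-product≡2 -[1+ ℕ.suc (ℕ.suc m) ] -[1+ 0 ] x≤0 y≤0 ()
nonPositive-product≡2 -[1+ ℕ.suc m ] -[1+ ℕ.suc n ] x≤0 y≤0 xy≡2 =
  contradiction (ℕ.suc-injective (ℕ.suc-injective (ℤ.+-injective xy≡2))) (ℕ.m+1+n≢0 n)

module BaseProperties {c ℓ₁ ℓ₂ m ℓm} {K : OrderedField c ℓ₁ ℓ₂} {E : EuclideanSpace K m ℓm}
                      {Φ : RootSystem E} (Δ : Base Φ) where
  open RootSystem Φ
  open Base Δ
  -- The identity family lets `SubBase` speak about the whole base, with its own Cartan matrix as
  -- `C`.
  open SubBase Δ (λ b → b) (λ _ _ eq → eq) (λ b b′ → cartan (simple b) (simple b′)) (λ _ _ → ≡.refl) public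
    using (cartan-diagonal; cartan-symmetrisable; cartan≡0-sym; norm-root≉0)
    renaming (C-nonPositive to cartan-nonPositive)

  -- Both Cartan integers are 0 or both are -1. Recording this as an element of `Fin 2` makes the
  -- possible diagrams on four nodes a finite type to search.
  cartan-bond : ∀ {b b′} → b ≢ b′ → bonds b b′ ℤ.≤ 1ℤ →
                ∃[ k ] cartan (simple b) (simple b′) ≡ bond k × cartan (simple b′) (simple b) ≡ bond k
  cartan-bond {b} {b′} b≢b′ ≤1 = nonPositive-product≤1 _ _
    (cartan-nonPositive (b≢b′ ∘ ≡.sym)) (cartan-nonPositive b≢b′) (cartan≡0-sym _ _) (cartan≡0-sym _ _) ≤1

  cartan-bond≡ : ∀ {b b′} → b ≢ b′ → ∀ k → bonds b b′ ≡ + toℕ {2} k →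
                 cartan (simple b) (simple b′) ≡ bond k × cartan (simple b′) (simple b) ≡ bond k
  cartan-bond≡ b≢b′ k eq with cartan-bond b≢b′ (≡.subst (ℤ._≤ 1ℤ) (≡.sym eq) (ℤ.+≤+ (ℕ.s≤s⁻¹ (Fin.toℕ<n k))))
  ... | k′ , p , q with bond*bond-injective k k′ (≡.trans (≡.sym eq) (≡.cong₂ ℤ._*_ p q))
    where
    bond*bond-injective : ∀ k k′ → + toℕ k ≡ bond k′ ℤ.* bond k′ → k ≡ k′
    bond*bond-injective 0F 0F _ = ≡.refl
    bond*bond-injective 1F 1F _ = ≡.refl
  ...   | ≡.refl = p , q

-- Finite data for D₄ and F₄

matrix : ∀ {p} → Vec (Vec ℤ p) p → Fin p → Fin p → ℤ
matrix M j i = lookup (lookup M j) i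

⟨_,_,_,_⟩ : ℕ → ℕ → ℕ → ℕ → Vec ℤ 4
⟨ x , y , z , w ⟩ = + x ∷ + y ∷ + z ∷ + w ∷ []

-- Row j and column i hold ⟨αⱼ,αᵢ^∨⟩.
graph : (b₁₂ b₁₃ b₁₄ b₂₃ b₂₄ b₃₄ : Fin 2) → Fin 4 → Fin 4 → ℤ
graph b₁₂ b₁₃ b₁₄ b₂₃ b₂₄ b₃₄ = matrix
  ( (+ 2      ∷ bond b₁₂ ∷ bond b₁₃ ∷ bond b₁₄ ∷ [])
  ∷ (bond b₁₂ ∷ + 2      ∷ bond b₂₃ ∷ bond b₂₄ ∷ [])
  ∷ (bond b₁₃ ∷ bond b₂₃ ∷ + 2      ∷ bond b₃₄ ∷ [])
  ∷ (bond b₁₄ ∷ bond b₂₄ ∷ bond b₃₄ ∷ + 2      ∷ [])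
  ∷ [])

D₄ : Fin 4 → Fin 4 → ℤ
D₄ = graph 1F 0F 0F 1F 1F 0F

D₄-roots : List (Vec ℤ 4)
D₄-roots =
    ⟨ 1 , 0 , 0 , 0 ⟩ ∷ ⟨ 0 , 1 , 0 , 0 ⟩ ∷ ⟨ 0 , 0 , 1 , 0 ⟩ ∷ ⟨ 0 , 0 , 0 , 1 ⟩
  ∷ ⟨ 1 , 1 , 0 , 0 ⟩ ∷ ⟨ 0 , 1 , 1 , 0 ⟩ ∷ ⟨ 0 , 1 , 0 , 1 ⟩
  ∷ ⟨ 1 , 1 , 1 , 0 ⟩ ∷ ⟨ 1 , 1 , 0 , 1 ⟩ ∷ ⟨ 0 , 1 , 1 , 1 ⟩
  ∷ ⟨ 1 , 1 , 1 , 1 ⟩ ∷ ⟨ 1 , 2 , 1 , 1 ⟩ ∷ []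

-- Four pairwise orthogonal roots of equal length.
4A₁ : Fin 4 → Vec ℤ 4
4A₁ = lookup (⟨ 1 , 1 , 1 , 0 ⟩ ∷ ⟨ 1 , 1 , 0 , 1 ⟩ ∷ ⟨ 0 , 1 , 1 , 1 ⟩ ∷ ⟨ 0 , 1 , 0 , 0 ⟩ ∷ [])

-- Among the listed roots, each functional vanishes exactly on α₂ and two further members of `4A₁`;
-- any two members lie in one of these three zero sets.
D₄-functionals : List (Vec ℤ 4)
D₄-functionals =
    (1ℤ ∷ 0ℤ ∷ -1ℤ ∷ -1ℤ ∷ [])
  ∷ (1ℤ ∷ 0ℤ ∷ -1ℤ ∷ 1ℤ ∷ [])
  ∷ (1ℤ ∷ 0ℤ ∷ 1ℤ ∷ -1ℤ ∷ [])
  ∷ []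

D₄-closed : ClosedUnderReflections D₄ D₄-roots
D₄-closed = from-yes (closedUnderReflections? D₄ D₄-roots)

4A₁-planeClosed : PlaneClosed D₄-functionals D₄-roots 4A₁
4A₁-planeClosed = from-yes (planeClosed? D₄-functionals D₄-roots 4A₁)

SignCoherent : ∀ {p} → (Fin p → ℤ) → Set
SignCoherent v = (∀ j → 0ℤ ℤ.≤ v j) ⊎ (∀ j → v j ℤ.≤ 0ℤ)

starVector : Fin 3 → Vec ℤ 4
starVector = lookup (⟨ 1 , 1 , 1 , 0 ⟩ ∷ ⟨ 1 , 1 , 0 , 1 ⟩ ∷ ⟨ 0 , 1 , 1 , 1 ⟩ ∷ [])

-- The triangle on α₁, α₃, α₄ is missing because it never has to be tested alone: connectedness of
-- the three supports then gives α₂ at least two neighbours, so every node has degree at least 2 and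
-- the vector of all ones applies. In a tree with the three supports connected, α₂ is the centre, as
-- the only node common to them.
cycleVector : Fin 4 → Vec ℤ 4
cycleVector = lookup (⟨ 1 , 1 , 1 , 0 ⟩ ∷ ⟨ 1 , 1 , 0 , 1 ⟩ ∷ ⟨ 0 , 1 , 1 , 1 ⟩ ∷ ⟨ 1 , 1 , 1 , 1 ⟩ ∷ [])

-- Among the 2⁶ graphs on four vertices, those in which one of the three supports is
-- disconnected are excluded by sign coherence, and those containing a cycle by
-- positive definiteness, applied to the sum of the simple roots on the cycle.
star-graph : ∀ b₁₂ b₁₃ b₁₄ b₂₃ b₂₄ b₃₄ → let C = graph b₁₂ b₁₃ b₁₄ b₂₃ b₂₄ b₃₄ in
  (∀ t i → SignCoherent (reflect C i (lookup (starVector t)))) →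
  (∀ t → ¬ (∀ i → lookup (cycleVector t) i ℤ.* pairing C (lookup (cycleVector t)) i ℤ.≤ 0ℤ)) →
  ∀ j i → C j i ≡ D₄ j i
star-graph = from-yes
  (all? λ b₁₂ → all? λ b₁₃ → all? λ b₁₄ → all? λ b₂₃ → all? λ b₂₄ → all? λ b₃₄ →
   let C = graph b₁₂ b₁₃ b₁₄ b₂₃ b₂₄ b₃₄ in
   all? (λ t → all? λ i → signCoherent? (reflect C i (lookup (starVector t))))
   →-dec (all? (λ t → ¬? (all? λ i → lookup (cycleVector t) i ℤ.* pairing C (lookup (cycleVector t)) i ℤ.≤? 0ℤ))
   →-dec all? (λ j → all? λ i → C j i ℤ.≟ D₄ j i)))
  where
  signCoherent? : ∀ v → Dec (SignCoherent v)
  signCoherent? v = all? (λ j → 0ℤ ℤ.≤? v j) ⊎-dec all? (λ j → v j ℤ.≤? 0ℤ)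

F₄ : Fin 4 → Fin 4 → ℤ
F₄ = matrix
  ( (+ 2 ∷ -1ℤ      ∷ 0ℤ  ∷ 0ℤ  ∷ [])
  ∷ (-1ℤ ∷ + 2      ∷ -1ℤ ∷ 0ℤ  ∷ [])
  ∷ (0ℤ  ∷ -[1+ 1 ] ∷ + 2 ∷ -1ℤ ∷ [])
  ∷ (0ℤ  ∷ 0ℤ       ∷ -1ℤ ∷ + 2 ∷ [])
  ∷ [])

F₄-roots : List (Vec ℤ 4)
F₄-roots =
    ⟨ 1 , 0 , 0 , 0 ⟩ ∷ ⟨ 0 , 1 , 0 , 0 ⟩ ∷ ⟨ 0 , 0 , 1 , 0 ⟩ ∷ ⟨ 0 , 0 , 0 , 1 ⟩
  ∷ ⟨ 1 , 1 , 0 , 0 ⟩ ∷ ⟨ 0 , 1 , 1 , 0 ⟩ ∷ ⟨ 0 , 0 , 1 , 1 ⟩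
  ∷ ⟨ 0 , 2 , 1 , 0 ⟩ ∷ ⟨ 1 , 1 , 1 , 0 ⟩ ∷ ⟨ 0 , 1 , 1 , 1 ⟩
  ∷ ⟨ 1 , 2 , 1 , 0 ⟩ ∷ ⟨ 1 , 1 , 1 , 1 ⟩ ∷ ⟨ 0 , 2 , 1 , 1 ⟩
  ∷ ⟨ 2 , 2 , 1 , 0 ⟩ ∷ ⟨ 1 , 2 , 1 , 1 ⟩ ∷ ⟨ 0 , 2 , 2 , 1 ⟩
  ∷ ⟨ 2 , 2 , 1 , 1 ⟩ ∷ ⟨ 1 , 2 , 2 , 1 ⟩
  ∷ ⟨ 2 , 2 , 2 , 1 ⟩ ∷ ⟨ 1 , 3 , 2 , 1 ⟩
  ∷ ⟨ 2 , 3 , 2 , 1 ⟩ ∷ ⟨ 2 , 4 , 2 , 1 ⟩ ∷ ⟨ 2 , 4 , 3 , 1 ⟩ ∷ ⟨ 2 , 4 , 3 , 2 ⟩ ∷ []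

-- The first, third and fifth roots are long, the others short; the last two have height above 4.
2A₂ : Fin 6 → Vec ℤ 4
2A₂ = lookup
  ( ⟨ 0 , 0 , 1 , 0 ⟩ ∷ ⟨ 1 , 2 , 1 , 0 ⟩ ∷ ⟨ 0 , 2 , 1 , 1 ⟩ ∷ ⟨ 1 , 1 , 1 , 1 ⟩
  ∷ ⟨ 0 , 2 , 2 , 1 ⟩ ∷ ⟨ 2 , 3 , 2 , 1 ⟩ ∷ [])

-- Among the listed roots, each of the first three functionals vanishes on exactly four roots, all
-- in `2A₂`, and this settles all but two pairs. The third and sixth roots of `2A₂` need the fifth
-- and sixth functionals, the fifth and sixth roots need the fourth and seventh.
F₄-functionals : List (Vec ℤ 4)
F₄-functionals =
    (1ℤ  ∷ 1ℤ       ∷ 0ℤ       ∷ -[1+ 1 ] ∷ [])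
  ∷ (+ 2 ∷ -1ℤ      ∷ 0ℤ       ∷ -1ℤ      ∷ [])
  ∷ (+ 2 ∷ -1ℤ      ∷ 0ℤ       ∷ + 2      ∷ [])
  ∷ (1ℤ  ∷ -[1+ 1 ] ∷ 1ℤ       ∷ + 2      ∷ [])
  ∷ (0ℤ  ∷ 1ℤ       ∷ -1ℤ      ∷ -1ℤ      ∷ [])
  ∷ (1ℤ  ∷ 0ℤ       ∷ -[1+ 1 ] ∷ + 2      ∷ [])
  ∷ (0ℤ  ∷ 0ℤ       ∷ 1ℤ       ∷ -[1+ 1 ] ∷ [])
  ∷ []

F₄-closed : ClosedUnderReflections F₄ F₄-roots
F₄-closed = from-yes (closedUnderReflections? F₄ F₄-roots)

2A₂-planeClosed : PlaneClosed F₄-functionals F₄-roots 2A₂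
2A₂-planeClosed = from-yes (planeClosed? F₄-functionals F₄-roots 2A₂)

η : Fin 3 → Vec ℤ 4
η = lookup (⟨ 1 , 2 , 1 , 0 ⟩ ∷ ⟨ 1 , 1 , 1 , 1 ⟩ ∷ ⟨ 0 , 2 , 1 , 1 ⟩ ∷ [])

F₄-height≤4 : All (λ u → sumℤ (lookup u) ℤ.≤ + 4 → ∃[ t ] (∀ j → lookup u j ℤ.≤ lookup (η t) j)) F₄-roots
F₄-height≤4 = from-yes (All.all? (λ u →
  (sumℤ (lookup u) ℤ.≤? + 4) →-dec any? (λ t → all? λ j → lookup u j ℤ.≤? lookup (η t) j)) F₄-roots)

module _ {c ℓ₁ ℓ₂ m ℓm} {K : OrderedField c ℓ₁ ℓ₂} {E : EuclideanSpace K m ℓm}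
         (Φ : RootSystem E) (Δ : Base Φ) where
  private module K where
    open OrderedField K hiding (zero) public
    open OrderedFieldProperties K public
    open IsTotalOrder isTotalOrder public using (antisym; ≤-respˡ-≈; ≤-respʳ-≈)
    open RingProperties ring public
  open EuclideanSpace E
  open EuclideanSpaceProperties E
  open RootSystem Φ
  open Base Δ
  open BaseProperties Δ

  -- Star ideals in simply laced type

  module _ {I : Subset size} (ideal : IsOrderIdeal I) where

    star-not-lineClosed : SimplyLaced → IsStarIdeal I → ¬ LineClosed I
    star-not-lineClosed simplyLaced
      (a₁ , a₂ , a₃ , a₄ , (a₁≢a₂ , a₁≢a₃ , a₁≢a₄ , a₂≢a₃ , a₂≢a₄ , a₃≢a₄) ,
       (γ₁₂₃ , γ₁₂₃∈I , γ₁₂₃≈) , (γ₁₂₄ , γ₁₂₄∈I , γ₁₂₄≈) , (γ₂₃₄ , γ₂₃₄∈I , γ₂₃₄≈)) =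
      not-lineClosed D₄-closed 4A₁
        (from-yes (all? λ s → all? λ t → ≡-dec ℤ._≟_ (4A₁ s) (4A₁ t) →-dec (s Fin.≟ t)))
        4A₁-planeClosed
        0F (from-yes (all? λ t → ¬? (≡-dec ℤ._≟_ (4A₁ t) (tabulate (unit 0F)))))
        -- (α₁+α₂+α₃) + (α₁+α₂+α₄) - (α₂+α₃+α₄) - α₂ = 2α₁; the argument 1 stands for the multiplier
        -- 1 + 1.
        1 (lookup (1ℤ ∷ 1ℤ ∷ -1ℤ ∷ -1ℤ ∷ []))
        (λ { 0F → ≡.refl ; 1F → ≡.refl ; 2F → ≡.refl ; 3F → ≡.refl })
        T-roots (proj₁ ideal) (simple∈I 0F (from-yes (all? λ j → unit 0F j ℤ.≤? lookup (4A₁ 0F) j)) λ ())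
        λ { 0F _ → γ₁₂₃∈I ; 1F _ → γ₁₂₄∈I ; 2F _ → γ₂₃₄∈I
          ; 3F _ → simple∈I 1F (from-yes (all? λ j → unit 1F j ℤ.≤? lookup (4A₁ 0F) j)) λ () }
      where
      a : Fin 4 → Fin rank
      a = lookup (a₁ ∷ a₂ ∷ a₃ ∷ a₄ ∷ [])

      a-injective : ∀ i j → a i ≡ a j → i ≡ j
      a-injective = lookup-injective
        ((a₁≢a₂ ∷ a₁≢a₃ ∷ a₁≢a₄ ∷ []) ∷ (a₂≢a₃ ∷ a₂≢a₄ ∷ []) ∷ (a₃≢a₄ ∷ []) ∷ [] ∷ [])

      bondOf : ∀ {b b′} → b ≢ b′ → ∃[ k ] cartan (simple b) (simple b′) ≡ bond k × cartan (simple b′) (simple b) ≡ bond k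
      bondOf b≢b′ = cartan-bond b≢b′ (simplyLaced _ _ b≢b′)

      k₁₂ = bondOf a₁≢a₂
      k₁₃ = bondOf a₁≢a₃
      k₁₄ = bondOf a₁≢a₄
      k₂₃ = bondOf a₂≢a₃
      k₂₄ = bondOf a₂≢a₄
      k₃₄ = bondOf a₃≢a₄

      C : Fin 4 → Fin 4 → ℤ
      C = graph (proj₁ k₁₂) (proj₁ k₁₃) (proj₁ k₁₄) (proj₁ k₂₃) (proj₁ k₂₄) (proj₁ k₃₄)

      cartan≡C : ∀ j i → cartan (simple (a j)) (simple (a i)) ≡ C j i
      cartan≡C 0F 0F = cartan-diagonal _
      cartan≡C 0F 1F = proj₁ (proj₂ k₁₂)
      cartan≡C 0F 2F = proj₁ (proj₂ k₁₃)
      cartan≡C 0F 3F = proj₁ (proj₂ k₁₄)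
      cartan≡C 1F 0F = proj₂ (proj₂ k₁₂)
      cartan≡C 1F 1F = cartan-diagonal _
      cartan≡C 1F 2F = proj₁ (proj₂ k₂₃)
      cartan≡C 1F 3F = proj₁ (proj₂ k₂₄)
      cartan≡C 2F 0F = proj₂ (proj₂ k₁₃)
      cartan≡C 2F 1F = proj₂ (proj₂ k₂₃)
      cartan≡C 2F 2F = cartan-diagonal _
      cartan≡C 2F 3F = proj₁ (proj₂ k₃₄)
      cartan≡C 3F 0F = proj₂ (proj₂ k₁₄)
      cartan≡C 3F 1F = proj₂ (proj₂ k₂₄)
      cartan≡C 3F 2F = proj₂ (proj₂ k₃₄)
      cartan≡C 3F 3F = cartan-diagonal _

      -- Parametrised by the matrix because it is used twice: for the unknown graph, in order to
      -- identify it, and then for `D₄`.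
      module Star (C : Fin 4 → Fin 4 → ℤ) (cartan≡C : ∀ j i → cartan (simple (a j)) (simple (a i)) ≡ C j i) where
        open SubBase Δ a a-injective C cartan≡C

        sum₃-represents : ∀ {γ} i j k → root γ ≈ᴹ α (a i) +ᴹ α (a j) +ᴹ α (a k) →
                          (λ l → unit i l ℤ.+ unit j l ℤ.+ unit k l) represents γ
        sum₃-represents i j k γ≈ = expands-resp-≈ γ≈
          (expands-+ (expands-+ (unit-represents i) (unit-represents j)) (unit-represents k))

        index : Fin 3 → Fin size
        index = lookup (γ₁₂₃ ∷ γ₁₂₄ ∷ γ₂₃₄ ∷ [])

        star-represents : ∀ t → lookup (starVector t) represents index t
        star-represents 0F = expands-cong
          (λ { 0F → ≡.refl ; 1F → ≡.refl ; 2F → ≡.refl ; 3F → ≡.refl }) (sum₃-represents 0F 1F 2F γ₁₂₃≈)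
        star-represents 1F = expands-cong
          (λ { 0F → ≡.refl ; 1F → ≡.refl ; 2F → ≡.refl ; 3F → ≡.refl }) (sum₃-represents 0F 1F 3F γ₁₂₄≈)
        star-represents 2F = expands-cong
          (λ { 0F → ≡.refl ; 1F → ≡.refl ; 2F → ≡.refl ; 3F → ≡.refl }) (sum₃-represents 1F 2F 3F γ₂₃₄≈)

      C≡D₄ : ∀ j i → C j i ≡ D₄ j i
      C≡D₄ = star-graph (proj₁ k₁₂) (proj₁ k₁₃) (proj₁ k₁₄) (proj₁ k₂₃) (proj₁ k₂₄) (proj₁ k₃₄)
        (λ t i → represents-signCoherent (proj₂ (reflect-represents (star-represents t) i)))
        -- All four cycle vectors have second coordinate 1.
        (λ t v*≤0 → contradiction (nonPositive⇒≡0 (lookup (cycleVector t)) v*≤0 1F) (cycleVector-nonzero t))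
        where
        open SubBase Δ a a-injective C cartan≡C
        open Star C cartan≡C
        cycleVector-nonzero : ∀ t → lookup (cycleVector t) 1F ≢ 0ℤ
        cycleVector-nonzero = from-yes (all? λ t → ¬? (lookup (cycleVector t) 1F ℤ.≟ 0ℤ))

      cartan≡D₄ : ∀ j i → cartan (simple (a j)) (simple (a i)) ≡ D₄ j i
      cartan≡D₄ j i = ≡.trans (cartan≡C j i) (C≡D₄ j i)

      open SubBase Δ a a-injective D₄ cartan≡D₄
      open LineClosure Δ a a-injective D₄ cartan≡D₄
      open Star D₄ cartan≡D₄ using (star-represents)

      index : Fin 4 → Fin size
      index = lookup (γ₁₂₃ ∷ γ₁₂₄ ∷ γ₂₃₄ ∷ simple a₂ ∷ [])

      T-roots : ∀ t → lookup (4A₁ t) represents index t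
      T-roots 0F = star-represents 0F
      T-roots 1F = star-represents 1F
      T-roots 2F = star-represents 2F
      T-roots 3F = expands-cong (λ { 0F → ≡.refl ; 1F → ≡.refl ; 2F → ≡.refl ; 3F → ≡.refl }) (unit-represents 1F)

      -- α₁ and α₂ enter the ideal from below α₁+α₂+α₃; the inequality of vectors provides the
      -- strictness in `_≺_`.
      simple∈I : ∀ i → (∀ j → unit i j ℤ.≤ lookup (4A₁ 0F) j) → tabulate (unit i) ≢ 4A₁ 0F → simple (a i) ∈ I
      simple∈I i unit≤ unit≢ = proj₂ ideal γ₁₂₃ (simple (a i)) γ₁₂₃∈I
        (represents-positive (unit-represents i) (unit-nonNegative i))
        (represents-≼ (unit-represents i) (T-roots 0F) unit≤ , λ eq → unit≢ (≡.trans (tabulate-cong λ j →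
          ≡.trans (≡.sym (represents-coeff (unit-represents i) j))
            (≡.trans (≡.cong (λ γ → coeff γ (a j)) eq) (represents-coeff (T-roots 0F) j))) (tabulate∘lookup (4A₁ 0F))))
        where
        unit-nonNegative : ∀ i j → 0ℤ ℤ.≤ unit i j
        unit-nonNegative i j with i Fin.≟ j
        ... | yes _ = ℤ.+≤+ ℕ.z≤n
        ... | no _  = ℤ.+≤+ ℕ.z≤n

  -- Type F₄

  module F₄-Properties (typeF₄ : TypeF₄ Δ) where
    open TypeF₄ typeF₄

    a : Fin 4 → Fin rank
    a = Inverse.to labelling

    a-injective : ∀ i j → a i ≡ a j → i ≡ j
    a-injective i j eq = ≡.trans (≡.sym (Inverse.strictlyInverseʳ labelling i))
      (≡.trans (≡.cong (Inverse.from labelling) eq) (Inverse.strictlyInverseʳ labelling j))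

    a-distinct : ∀ {i j} → i ≢ j → a i ≢ a j
    a-distinct i≢j eq = i≢j (a-injective _ _ eq)

    -- A product of 2 leaves two orientations of the double bond. The wrong one gives ⟪α₂,α₂⟫ =
    -- 2⟪α₃,α₃⟫ by symmetrisability; with ⟪α₂,α₂⟫ ≤ ⟪α₃,α₃⟫ this forces α₃ to have norm 0.
    cartan₂₃ : cartan (simple a₂) (simple a₃) ≡ -1ℤ × cartan (simple a₃) (simple a₂) ≡ -[1+ 1 ]
    cartan₂₃ with nonPositive-product≡2 _ _
                    (cartan-nonPositive (a-distinct {2F} {1F} λ ())) (cartan-nonPositive (a-distinct {1F} {2F} λ ())) bonds₂₃
    ... | inj₁ eqs = eqs
    ... | inj₂ (c₂₃≡-2 , c₃₂≡-1) = contradiction N₃≈0 (norm-root≉0 (simple a₃))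
      where
      open SetoidReasoning K.setoid
      N₂ = ⟪ α₂ , α₂ ⟫
      N₃ = ⟪ α₃ , α₃ ⟫

      negated : K.- (N₃ K.+ N₃) K.≈ K.- N₂
      negated = begin
        K.- (N₃ K.+ N₃)                                       ≈⟨ K.-‿cong (K.+-cong (K.*-identityˡ N₃) (K.*-identityˡ N₃)) ⟨
        K.- (K.1# K.* N₃ K.+ K.1# K.* N₃)                     ≈⟨ K.-‿cong (K.distribʳ N₃ K.1# K.1#) ⟨
        K.- ((K.1# K.+ K.1#) K.* N₃)                          ≈⟨ K.-‿distribˡ-* _ _ ⟩
        K.- (K.1# K.+ K.1#) K.* N₃                            ≈⟨ K.*-congʳ (K.-‿cong (K.+-congˡ K.fromℤ-1)) ⟨
        K.fromℤ -[1+ 1 ] K.* N₃                               ≡⟨ ≡.cong (λ x → K.fromℤ x K.* N₃) c₂₃≡-2 ⟨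
        K.fromℤ (cartan (simple a₂) (simple a₃)) K.* N₃       ≈⟨ cartan-symmetrisable (simple a₂) (simple a₃) ⟩
        K.fromℤ (cartan (simple a₃) (simple a₂)) K.* N₂       ≡⟨ ≡.cong (λ x → K.fromℤ x K.* N₂) c₃₂≡-1 ⟩
        K.fromℤ -1ℤ K.* N₂                                    ≈⟨ K.*-congʳ (K.-‿cong K.fromℤ-1) ⟩
        K.- K.1# K.* N₂                                       ≈⟨ K.-1*x≈-x N₂ ⟩
        K.- N₂                                                ∎

      N₃+N₃≤N₃ : N₃ K.+ N₃ K.≤ N₃
      N₃+N₃≤N₃ = K.≤-respˡ-≈ (K.sym (K.-‿injective negated)) (proj₁ short<long)

      N₃≤0 : N₃ K.≤ K.0#
      N₃≤0 = K.≤-respʳ-≈ (K.-‿inverseʳ N₃) (K.≤-respˡ-≈ (begin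
        N₃ K.+ N₃ K.+ K.- N₃      ≈⟨ K.+-assoc _ _ _ ⟩
        N₃ K.+ (N₃ K.+ K.- N₃)    ≈⟨ K.+-congˡ (K.-‿inverseʳ N₃) ⟩
        N₃ K.+ K.0#               ≈⟨ K.+-identityʳ N₃ ⟩
        N₃                        ∎) (K.+-monoˡ-≤ (K.- N₃) N₃+N₃≤N₃))

      N₃≈0 : N₃ K.≈ K.0#
      N₃≈0 = K.antisym N₃≤0 (⟪⟫-nonNegative α₃)

    cartan≡F₄ : ∀ j i → cartan (simple (a j)) (simple (a i)) ≡ F₄ j i
    cartan≡F₄ 0F 0F = cartan-diagonal _
    cartan≡F₄ 0F 1F = proj₁ (cartan-bond≡ (a-distinct λ ()) 1F bonds₁₂)
    cartan≡F₄ 0F 2F = proj₁ (cartan-bond≡ (a-distinct λ ()) 0F bonds₁₃)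
    cartan≡F₄ 0F 3F = proj₁ (cartan-bond≡ (a-distinct λ ()) 0F bonds₁₄)
    cartan≡F₄ 1F 0F = proj₂ (cartan-bond≡ (a-distinct λ ()) 1F bonds₁₂)
    cartan≡F₄ 1F 1F = cartan-diagonal _
    cartan≡F₄ 1F 2F = proj₁ cartan₂₃
    cartan≡F₄ 1F 3F = proj₁ (cartan-bond≡ (a-distinct λ ()) 0F bonds₂₄)
    cartan≡F₄ 2F 0F = proj₂ (cartan-bond≡ (a-distinct λ ()) 0F bonds₁₃)
    cartan≡F₄ 2F 1F = proj₂ cartan₂₃
    cartan≡F₄ 2F 2F = cartan-diagonal _
    cartan≡F₄ 2F 3F = proj₁ (cartan-bond≡ (a-distinct λ ()) 1F bonds₃₄)
    cartan≡F₄ 3F 0F = proj₂ (cartan-bond≡ (a-distinct λ ()) 0F bonds₁₄)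
    cartan≡F₄ 3F 1F = proj₂ (cartan-bond≡ (a-distinct λ ()) 0F bonds₂₄)
    cartan≡F₄ 3F 2F = proj₂ (cartan-bond≡ (a-distinct λ ()) 1F bonds₃₄)
    cartan≡F₄ 3F 3F = cartan-diagonal _

    open SubBase Δ a a-injective F₄ cartan≡F₄
    open LineClosure Δ a a-injective F₄ cartan≡F₄

    η-vector : Fin 3 → Carrierᴹ
    η-vector = lookup (η₁ ∷ η₂ ∷ η₃ ∷ [])

    η-expands : ∀ t → lookup (η t) expands η-vector t
    η-expands t = expands-cong (values t) (sums t)
      where
      units : Fin 3 → Fin 4 → ℤ
      units 0F j = unit 0F j ℤ.+ (unit 1F j ℤ.+ unit 1F j) ℤ.+ unit 2F j
      units 1F j = unit 0F j ℤ.+ unit 1F j ℤ.+ unit 2F j ℤ.+ unit 3F j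
      units 2F j = (unit 1F j ℤ.+ unit 1F j) ℤ.+ unit 2F j ℤ.+ unit 3F j

      values : ∀ t j → units t j ≡ lookup (η t) j
      values = from-yes (all? λ t → all? λ j → units t j ℤ.≟ lookup (η t) j)

      e : ∀ i → unit i expands α (a i)
      e = unit-represents

      sums : ∀ t → units t expands η-vector t
      sums 0F = expands-+ (expands-+ (e 0F) (expands-+ (e 1F) (e 1F))) (e 2F)
      sums 1F = expands-+ (expands-+ (expands-+ (e 0F) (e 1F)) (e 2F)) (e 3F)
      sums 2F = expands-+ (expands-+ (expands-+ (e 1F) (e 1F)) (e 2F)) (e 3F)

    -- The labelling exhausts the base, so every root lies in the span of the four.
    coeff-represents : ∀ γ → coeff γ ∘ a represents γ
    coeff-represents γ = by (≈ᴹ-trans (coeff-def γ) (linComb-image a a-injective _ α λ b b∉a →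
      contradiction (Inverse.strictlyInverseˡ labelling b) (b∉a (Inverse.from labelling b))))

    -- Each word is a descent to a simple root run backwards: read from the right, every letter
    -- raises the height.
    2A₂-root : ∀ t → ∃[ γ ] lookup (2A₂ t) represents γ
    2A₂-root 0F = word-represents [] 2F
    2A₂-root 1F = word-represents (1F ∷ 2F ∷ 1F ∷ []) 0F
    2A₂-root 2F = word-represents (3F ∷ 1F ∷ []) 2F
    2A₂-root 3F = word-represents (3F ∷ 2F ∷ 1F ∷ []) 0F
    2A₂-root 4F = word-represents (2F ∷ 3F ∷ 1F ∷ []) 2F
    2A₂-root 5F = word-represents (0F ∷ 1F ∷ 2F ∷ 3F ∷ 1F ∷ 2F ∷ 1F ∷ []) 0F

    η-root : ∀ t → ∃[ γ ] lookup (η t) represents γ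
    η-root 0F = 2A₂-root 1F
    η-root 1F = 2A₂-root 3F
    η-root 2F = 2A₂-root 2F

    -- The generators η₁, η₂, η₃ are exactly the roots of height 4, and the height is monotone.
    -- Conversely, the complete list shows that each positive root of height at most 4 lies below
    -- one of them.
    Î⇔height≤4 : ∀ γ → Î γ ⇔ (Positive γ × height γ ℤ.≤ + 4)
    Î⇔height≤4 γ = mk⇔
      (λ { (γ-positive , δ , _ , δ≈η , γ≼δ) →
        γ-positive , ℤ.≤-trans (sumℤ-mono-≤ γ≼δ) (ℤ.≤-reflexive (η-height δ≈η)) })
      (λ (γ-positive , height≤4) → γ-positive , below γ-positive height≤4)
      where
      height-4 : ∀ {δ} t → root δ ≈ᴹ η-vector t → height δ ≡ + 4
      height-4 t δ≈η = ≡.trans (represents-height (expands-resp-≈ δ≈η (η-expands t)))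
        (from-yes (all? λ t → sumℤ (lookup (η t)) ℤ.≟ + 4) t)

      η-height : ∀ {δ} → root δ ≈ᴹ η₁ ⊎ root δ ≈ᴹ η₂ ⊎ root δ ≈ᴹ η₃ → height δ ≡ + 4
      η-height = [ height-4 0F , [ height-4 1F , height-4 2F ]′ ]′

      choose : ∀ {δ} t → root δ ≈ᴹ η-vector t → root δ ≈ᴹ η₁ ⊎ root δ ≈ᴹ η₂ ⊎ root δ ≈ᴹ η₃
      choose 0F = inj₁
      choose 1F = inj₂ ∘ inj₁
      choose 2F = inj₂ ∘ inj₂

      below : Positive γ → height γ ℤ.≤ + 4 →
              ∃[ δ ] Positive δ × (root δ ≈ᴹ η₁ ⊎ root δ ≈ᴹ η₂ ⊎ root δ ≈ᴹ η₃) × γ ≼ δ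
      below γ-positive height≤4 = δ , represents-positive η∼δ (η-nonNegative t) ,
        choose t (≈ᴹ-trans (expansion η∼δ) (≈ᴹ-sym (expansion (η-expands t)))) ,
        represents-≼ (coeff-represents γ) η∼δ (λ j → ≡.subst (ℤ._≤ lookup (η t) j) (lookup∘tabulate u j) (proj₂ u≤η j))
        where
        u : Fin 4 → ℤ
        u = coeff γ ∘ a
        Σu≤4 : sumℤ (lookup (tabulate u)) ℤ.≤ + 4
        Σu≤4 = ≡.subst (ℤ._≤ + 4)
          (represents-height (expands-cong (λ j → ≡.sym (lookup∘tabulate u j)) (coeff-represents γ))) height≤4
        u≤η = All.lookup F₄-height≤4 (positive-root∈ F₄-closed (coeff-represents γ) (γ-positive ∘ a)) Σu≤4
        t = proj₁ u≤η
        δ = proj₁ (η-root t)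
        η∼δ = proj₂ (η-root t)
        η-nonNegative : ∀ t j → 0ℤ ℤ.≤ lookup (η t) j
        η-nonNegative = from-yes (all? λ t → all? λ j → 0ℤ ℤ.≤? lookup (η t) j)

    Î-not-lineClosed : ∀ {I} → IsOrderIdeal I → (∀ γ → Î γ → γ ∈ I) → ¬ LineClosed I
    Î-not-lineClosed {I} ideal Î⊆I =
      not-lineClosed F₄-closed 2A₂
        (from-yes (all? λ s → all? λ t → ≡-dec ℤ._≟_ (2A₂ s) (2A₂ t) →-dec (s Fin.≟ t)))
        2A₂-planeClosed
        0F (from-yes (all? λ t → ¬? (≡-dec ℤ._≟_ (2A₂ t) (tabulate (unit 0F)))))
        -- -α₃ + (α₁+2α₂+α₃) - 2(2α₂+α₃+α₄) + 2(α₁+α₂+α₃+α₄) = 3α₁; the argument 2 stands for the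
        -- multiplier 2 + 1. The roots of height 5 and 8 get coefficient 0, since `I` may fail to
        -- contain them.
        2 k
        (λ { 0F → ≡.refl ; 1F → ≡.refl ; 2F → ≡.refl ; 3F → ≡.refl })
        (proj₂ ∘ 2A₂-root) (proj₁ ideal)
        (low∈I (unit-represents 0F) (from-yes (all? λ j → 0ℤ ℤ.≤? unit {4} 0F j))
          (from-yes (sumℤ (unit {4} 0F) ℤ.≤? + 4)))
        (λ t kt≢0 → low∈I (proj₂ (2A₂-root t))
          (from-yes (all? λ t → all? λ j → 0ℤ ℤ.≤? lookup (2A₂ t) j) t)
          (from-yes (all? λ t → ¬? (k t ℤ.≟ 0ℤ) →-dec (sumℤ (lookup (2A₂ t)) ℤ.≤? + 4)) t kt≢0))
      where
      k : Fin 6 → ℤ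
      k = lookup (-1ℤ ∷ 1ℤ ∷ -[1+ 1 ] ∷ + 2 ∷ 0ℤ ∷ 0ℤ ∷ [])

      low∈I : ∀ {γ v} → v represents γ → (∀ j → 0ℤ ℤ.≤ v j) → sumℤ v ℤ.≤ + 4 → γ ∈ I
      low∈I {γ} v∼γ 0≤v Σv≤4 = Î⊆I γ (Equivalence.from (Î⇔height≤4 γ)
        (represents-positive v∼γ 0≤v , ≡.subst (ℤ._≤ + 4) (≡.sym (represents-height v∼γ)) Σv≤4))

open import Data.Integer.Base using (_≤_)

proposition8p2 :
    ∀ {c ℓ₁ ℓ₂ m ℓm} {K : OrderedField c ℓ₁ ℓ₂} {E : EuclideanSpace K m ℓm}
      (Φ : RootSystem E) (Δ : Base Φ) →
    let open RootSystem Φ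
        open Base Δ
    in (I : Subset size) → IsOrderIdeal I →
         (SimplyLaced → IsStarIdeal I → ¬ LineClosed I)
       × ((F₄ : TypeF₄ Δ) → let open TypeF₄ F₄ using (Î) in
            (∀ γ → Î γ ⇔ (Positive γ × height γ ≤ + 4))
          × ((∀ γ → Î γ → γ ∈ I) → ¬ LineClosed I))
proposition8p2 Φ Δ I ideal =
    star-not-lineClosed Φ Δ ideal
  , λ typeF₄ → F₄-Properties.Î⇔height≤4 Φ Δ typeF₄ , F₄-Properties.Î-not-lineClosed Φ Δ typeF₄ ideal
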